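{- The sure reachability problem and the sure repeated reachability problem are decidable for deadlock-free P-VASS-MDPs.
   Context: A VASS-MDP of dimension $d\ge 0$ is a tuple $S=\langle Q,Q_1,Q_P,T,\tau\rangle$ where $Q$ is a finite set of control states partitioned into $Q_1$ (Player 1) and $Q_P$ (probabilistic), $T\subseteq Q\times\mathbb{Z}^d\times Q$ is finite, and $\tau:T\to\mathbb{N}_{>0}$. Configurations are $\langle q,\mathbf{v}\rangle\in Q\times\mathbb{N}^d$; $t=\langle q,\mathbf{z},q'\rangle$ is enabled in $\langle q,\mathbf{v}\rangle$ if $\mathbf{v}+\mathbf{z}\in\mathbb{N}^d$ and leads to $\langle q',\mathbf{v}+\mathbf{z}\rangle$. The induced MDP $M_S=\langle C,C_1,C_P,\rightarrow,p\rangle$ has $C=Q\times\mathbb{N}^d$, $C_1=Q_1\times\mathbb{N}^d$, $C_P=Q_P\times\mathbb{N}^d$, $c\rightarrow c'$ iff $c'$ is obtained from $c$ by an enabled transition, and for $c\in C_P$, $p(c)(c')$ is the total weight of enabled transitions from $c$ leading to $c'$ divided by the total weight of transitions enabled in $c$. A configuration without successor is a deadlock; $S$ is deadlock-free if $M_S$ has no deadlock configuration. A P-VASS-MDP is a VASS-MDP in which every transition $\langle q,\mathbf{z},q'\rangle$ with $q\in Q_1$ has $\mathbf{z}=\mathbf{0}$. A strategy $\sigma$ of Player 1 maps each finite play (sequence $c_0\cdots c_n$ with $c_i\rightarrow c_{i+1}$) ending in $c\in C_1$ to a successor of $c$; $\mathrm{Outcome}(M_S,c,\sigma)$ is the set of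 maximal plays from $c$ consistent with $\sigma$. For $q_F\in Q$, $[\![\Diamond q_F]\!]$ (resp. $[\![\Box\Diamond q_F]\!]$) is the set of plays visiting a configuration with control state $q_F$ at least once (resp. infinitely often). The sure reachability (resp. sure repeated reachability) problem asks, given $S$, an initial configuration $c_0$ and $q_F\in Q$, whether there exists $\sigma$ with $\mathrm{Outcome}(M_S,c_0,\sigma)\subseteq[\![\Diamond q_F]\!]$ (resp. $\subseteq[\![\Box\Diamond q_F]\!]$). -}

module Defs where

open import Data.Nat using (ℕ; zero; suc; _≤_; _<_; NonZero)
open import Data.Integer as ℤ using (ℤ; +_)
open import Data.Fin using (Fin)
open import Data.Vec using (Vec; zipWith; map; replicate)
open import Data.List using (List; []; _∷_)
open import Data.List.Membership.Propositional using (_∈_)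
open import Data.Product using (Σ; ∃; _×_; _,_; proj₁; proj₂)
open import Data.Unit using (⊤)
open import Data.Empty using (⊥)
open import Relation.Binary.PropositionalEquality using (_≡_)
open import Relation.Nullary using (¬_)

data Owner : Set where
  player1 prob : Owner

record Transition (n d : ℕ) : Set where
  constructor trans
  field
    src    : Fin n
    upd    : Vec ℤ d
    tgt    : Fin n
    weight : ℕ
    .{{weight-pos}} : NonZero weight
open Transition public

-- VASS-MDP S = ⟨Q, Q1, QP, T, τ⟩ with Q = Fin n; the partition is given by 'owner'.
record VASSMDP (n d : ℕ) : Set where
  field
    owner       : Fin n → Owner
    transitions : List (Transition n d)
open VASSMDP public

Config : ℕ → ℕ → Set
Config n d = Fin n × Vec ℕ d

state : ∀ {n d} → Config n d → Fin n
state = proj₁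

-- t is enabled in ⟨q,v⟩ and leads to ⟨q',v'⟩ : src t = q, tgt t = q', v + z = v' (so v+z ∈ ℕ^d).
Fires : ∀ {n d} → Transition n d → Config n d → Config n d → Set
Fires t (q , v) (q' , v') =
  src t ≡ q × tgt t ≡ q' × zipWith ℤ._+_ (map +_ v) (upd t) ≡ map +_ v'

Step : ∀ {n d} → VASSMDP n d → Config n d → Config n d → Set
Step S c c' = ∃ λ t → t ∈ transitions S × Fires t c c'

Deadlock : ∀ {n d} → VASSMDP n d → Config n d → Set
Deadlock S c = ∀ c' → ¬ Step S c c'

DeadlockFree : ∀ {n d} → VASSMDP n d → Set
DeadlockFree S = ∀ c → ¬ Deadlock S c

IsPVASS : ∀ {n d} → VASSMDP n d → Set
IsPVASS {d = d} S = ∀ t → t ∈ transitions S → owner S (src t) ≡ player1 → upd t ≡ replicate d (+ 0)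

-- Finite sequence c₀ ⋯ c_k given by ρ (entries with index > k irrelevant) is a play.
IsPlayUpTo : ∀ {n d} → VASSMDP n d → (ℕ → Config n d) → ℕ → Set
IsPlayUpTo S ρ k = ∀ i → i < k → Step S (ρ i) (ρ (suc i))

prefix : ∀ {A : Set} → (ℕ → A) → ℕ → List A
prefix ρ zero    = []
prefix ρ (suc i) = ρ zero ∷ prefix (λ j → ρ (suc j)) i

record Strategy {n d} (S : VASSMDP n d) : Set where
  field
    choose : List (Config n d) → Config n d → Config n d
    valid  : ∀ (ρ : ℕ → Config n d) k → IsPlayUpTo S ρ k →
             owner S (state (ρ k)) ≡ player1 →
             (∃ λ c' → Step S (ρ k) c') →
             Step S (ρ k) (choose (prefix ρ k) (ρ k))
open Strategy public

-- Maximal plays: either infinite, or finite of length k+1 ending in a deadlock.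
data Play (n d : ℕ) : Set where
  inf : (ℕ → Config n d) → Play n d
  fin : ℕ → (ℕ → Config n d) → Play n d

Consistent : ∀ {n d} {S : VASSMDP n d} → Strategy S → (ℕ → Config n d) → ℕ → Set
Consistent {S = S} σ ρ i =
  owner S (state (ρ i)) ≡ player1 → ρ (suc i) ≡ choose σ (prefix ρ i) (ρ i)

Outcome : ∀ {n d} (S : VASSMDP n d) → Config n d → Strategy S → Play n d → Set
Outcome S c₀ σ (inf ρ) =
  ρ 0 ≡ c₀ × (∀ i → Step S (ρ i) (ρ (suc i))) × (∀ i → Consistent σ ρ i)
Outcome S c₀ σ (fin k ρ) =
  ρ 0 ≡ c₀ × IsPlayUpTo S ρ k × Deadlock S (ρ k) × (∀ i → i < k → Consistent σ ρ i)

Reach : ∀ {n d} → Fin n → Play n d → Set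
Reach qF (inf ρ)   = ∃ λ i → state (ρ i) ≡ qF
Reach qF (fin k ρ) = ∃ λ i → i ≤ k × state (ρ i) ≡ qF

RepReach : ∀ {n d} → Fin n → Play n d → Set
RepReach qF (inf ρ)   = ∀ N → ∃ λ i → N ≤ i × state (ρ i) ≡ qF
RepReach qF (fin k ρ) = ∀ N → ∃ λ i → N ≤ i × i ≤ k × state (ρ i) ≡ qF

SureReach : ∀ {n d} → VASSMDP n d → Config n d → Fin n → Set
SureReach S c₀ qF = ∃ λ (σ : Strategy S) → ∀ π → Outcome S c₀ σ π → Reach qF π

SureRepReach : ∀ {n d} → VASSMDP n d → Config n d → Fin n → Set
SureRepReach S c₀ qF = ∃ λ (σ : Strategy S) → ∀ π → Outcome S c₀ σ π → RepReach qF π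

{-# OPTIONS --safe #-}
module Submission where

-- Give the opponent a further counter from which one unit is paid on leaving qF. The opponent
-- survives in this energy game from credit m iff qF can be held to at most m visits. So Player 1
-- surely reaches qF iff she wins for m = 0, and surely visits qF infinitely often iff she wins for
-- every m; as soon as one credit N separates these two cases uniformly, both are decided and
-- Player 1 has memoryless strategies.
--
-- Such an N exists for any set C of counters with given initial values, by induction on C: once a
-- counter c in C is as large as the bound K that works for C - c, the outcome is the one for C - c,
-- hence all counters in C may be kept below K and moved into the control states. This leaves finite
-- games in which all initial credits are unknown. There the choices of Player 1 may be fixed one by
-- one, because the opponent can interleave plays of two restricted games on separate credits. With
-- no choice left for Player 1, the opponent survives iff a closed walk with nonnegative effect is
-- reachable: the effects of walks form semilinear sets (Kleene), nonnegativity is decided by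
-- Fourier-Motzkin elimination, and without such a walk all plays are finite by Dickson's lemma.

open import Defs hiding (trans)
open import Data.Nat as ℕ using (ℕ; zero; suc; z≤n; s≤s)
import Data.Nat.Properties as ℕₚ
open import Data.Integer using (ℤ; +_; +[1+_]; -[1+_]; _+_; _*_; -_; _≤_; +≤+; drop‿+≤+; ∣_∣; _≤?_)
open import Data.Integer.Properties hiding (_≟_)
open import Data.Integer.Tactic.RingSolver using (solve-∀)
open import Data.Rational.Unnormalised as ℚᵘ using (mkℚᵘ; *≤*)
import Data.Rational.Unnormalised.Properties as ℚᵘₚ
open import Data.Fin using (Fin; zero; suc; toℕ; fromℕ<)
import Data.Fin.Properties as Finₚ
open import Data.Fin.Subset using (Subset; outside; ⊤; _-_; _⊂_) renaming (_∈_ to _∈ₚ_; _∉_ to _∉ₚ_)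
open import Data.Fin.Subset.Properties using (_∈?_; ∈⊤; p─q⊆p; x∈p⇒p-x⊂p; x∈p∧x≢y⇒x∈p-y)
open import Data.Fin.Subset.Induction using (⊂-wellFounded; Acc; acc)
open import Data.Vec as Vec using (Vec; []; _∷_; lookup; tabulate; there)
open import Data.Vec.Properties
  using (≡-dec; lookup∘tabulate; tabulate∘lookup; tabulate-cong; lookup-zipWith; lookup-map; lookup-replicate)
open import Data.List as List
  using (List; []; _∷_; _++_; map; filter; length; allFin; cartesianProductWith)
open import Data.List.Extrema ℚᵘₚ.≤-totalOrder
  using (argmin; argmin-sel; f[argmin]≤f[⊤]; f[argmin]≤f[xs])
open import Data.List.Membership.Propositional using (_∈_; find; lose)
open import Data.List.Membership.Propositional.Properties
  using (∈-++⁺ˡ; ∈-++⁺ʳ; ∈-++⁻; ∈-map⁺; ∈-map⁻; ∈-filter⁺; ∈-filter⁻; ∈-allFin;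
         ∈-cartesianProductWith⁺; ∈-cartesianProductWith⁻)
open import Data.List.Relation.Unary.Any as Any using (Any; here; there; any?; index)
open import Data.List.Relation.Unary.Any.Properties using (lookup-index)
open import Data.List.Relation.Unary.All as All using (All; all?)
open import Data.Product using (_×_; _,_; ∃; ∃₂; proj₁; proj₂)
open import Data.Sum using (_⊎_; inj₁; inj₂; map₁; swap)
open import Data.Empty using (⊥; ⊥-elim)
import Data.Unit as Unit
open import Relation.Nullary using (Dec; yes; no; ¬_)
open import Relation.Nullary.Decidable using (map′; ¬?; _×-dec_; _⊎-dec_; decidable-stable)
open import Relation.Binary.PropositionalEquality
  using (_≡_; _≢_; refl; sym; trans; cong; cong₂; subst; subst₂)

-- Almost-full relations and Dickson's lemma

-- Almost-full relations (Vytiniotis, Coquand, Wahlstedt): an inductive, constructive form of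
-- "every infinite sequence contains i < j with R xᵢ xⱼ".
data AlmostFull {A : Set} (R : A → A → Set) : Set where
  now   : (∀ x y → R x y) → AlmostFull R
  later : (∀ x → AlmostFull (λ y z → R y z ⊎ R x y)) → AlmostFull R

af-mono : {A : Set} {R S : A → A → Set} → (∀ {x y} → R x y → S x y) →
          AlmostFull R → AlmostFull S
af-mono R⊆S (now r)   = now λ x y → R⊆S (r x y)
af-mono R⊆S (later f) = later λ x → af-mono
  (λ { (inj₁ r) → inj₁ (R⊆S r) ; (inj₂ r) → inj₂ (R⊆S r) }) (f x)

af-comap : {A B : Set} {R : B → B → Set} (f : A → B) →
           AlmostFull R → AlmostFull (λ x y → R (f x) (f y))
af-comap f (now r)   = now λ x y → r (f x) (f y)
af-comap f (later g) = later λ x → af-comap f (g (f x))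

private
  ⊎-× : {C S T : Set} → C ⊎ S → C ⊎ T → C ⊎ S × T
  ⊎-× (inj₁ c) _        = inj₁ c
  ⊎-× (inj₂ s) (inj₁ c) = inj₁ c
  ⊎-× (inj₂ s) (inj₂ t) = inj₂ (s , t)

  regroup : {B D E F : Set} → (B ⊎ (D ⊎ F)) ⊎ E → (B ⊎ (D ⊎ E)) ⊎ F
  regroup (inj₁ (inj₁ b))        = inj₁ (inj₁ b)
  regroup (inj₁ (inj₂ (inj₁ d))) = inj₁ (inj₂ (inj₁ d))
  regroup (inj₁ (inj₂ (inj₂ f))) = inj₂ f
  regroup (inj₂ e)               = inj₁ (inj₂ (inj₂ e))

  flatten : {B D E F : Set} → (B ⊎ (D ⊎ E)) ⊎ F → (B ⊎ E) ⊎ (D ⊎ F)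
  flatten (inj₁ (inj₁ b))        = inj₁ (inj₁ b)
  flatten (inj₁ (inj₂ (inj₁ d))) = inj₂ (inj₁ d)
  flatten (inj₁ (inj₂ (inj₂ e))) = inj₁ (inj₂ e)
  flatten (inj₂ f)               = inj₂ (inj₂ f)

-- First of three steps towards closure under intersection, a constructive Ramsey argument: `S` and
-- `T` depend on no element here, on one in `af-unary`, on two in `af-binary`. `C` collects the
-- alternatives that earlier elements have made available.
af-nullary : {A : Set} {P Q C : A → A → Set} {S T : Set} →
  AlmostFull P → (∀ {x y} → P x y → C x y ⊎ S) →
  AlmostFull Q → (∀ {x y} → Q x y → C x y ⊎ T) →
  AlmostFull (λ x y → C x y ⊎ S × T)
af-nullary (now p) P⊆ q Q⊆ = af-mono (λ {x} {y} r → ⊎-× (P⊆ (p x y)) (Q⊆ r)) q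
af-nullary {C = C} (later f) P⊆ q Q⊆ = later λ x → af-mono
  (λ { (inj₁ (inj₁ c)) → inj₁ (inj₁ c)
     ; (inj₁ (inj₂ c)) → inj₂ (inj₁ c)
     ; (inj₂ st)       → inj₁ (inj₂ st) })
  (af-nullary {C = λ y z → C y z ⊎ C x y} (f x)
    (λ { (inj₁ p) → map₁ inj₁ (P⊆ p) ; (inj₂ p) → map₁ inj₂ (P⊆ p) })
    q (λ r → map₁ inj₁ (Q⊆ r)))

-- Once the first element `x` is fixed, `S x` and `T x` are constants. Induction on either
-- derivation yields one of them as an alternative, and `af-nullary` intersects the two results.
af-unary : {A : Set} {P Q C : A → A → Set} {S T : A → Set} →
  AlmostFull P → (∀ {x y} → P x y → C x y ⊎ S x) →
  AlmostFull Q → (∀ {x y} → Q x y → C x y ⊎ T x) →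
  AlmostFull (λ x y → C x y ⊎ S x × T x)
af-unary (now p) P⊆ q Q⊆ = af-mono (λ {x} {y} r → ⊎-× (P⊆ (p x y)) (Q⊆ r)) q
af-unary p@(later _) P⊆ (now q) Q⊆ = af-mono (λ {x} {y} r → ⊎-× (P⊆ r) (Q⊆ (q x y))) p
af-unary {C = C} {S} {T} p@(later f) P⊆ q@(later g) Q⊆ = later λ x → af-mono flatten
  (af-nullary {C = λ y z → C y z ⊎ (C x y ⊎ S y × T y)}
    (af-unary {C = λ y z → C y z ⊎ (C x y ⊎ S x)} (f x)
      (λ { (inj₁ r) → map₁ inj₁ (P⊆ r) ; (inj₂ r) → inj₁ (inj₂ (P⊆ r)) })
      q (λ r → map₁ inj₁ (Q⊆ r)))
    regroup
    (af-unary {C = λ y z → C y z ⊎ (C x y ⊎ T x)} p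
      (λ r → map₁ inj₁ (P⊆ r))
      (g x) (λ { (inj₁ r) → map₁ inj₁ (Q⊆ r) ; (inj₂ r) → inj₁ (inj₂ (Q⊆ r)) }))
    regroup)

-- The same pattern one level up: with `x` fixed, `S x y` and `T x y` are unary in `y`.
af-binary : {A : Set} {P Q C S T : A → A → Set} →
  AlmostFull P → (∀ {x y} → P x y → C x y ⊎ S x y) →
  AlmostFull Q → (∀ {x y} → Q x y → C x y ⊎ T x y) →
  AlmostFull (λ x y → C x y ⊎ S x y × T x y)
af-binary (now p) P⊆ q Q⊆ = af-mono (λ {x} {y} r → ⊎-× (P⊆ (p x y)) (Q⊆ r)) q
af-binary p@(later _) P⊆ (now q) Q⊆ = af-mono (λ {x} {y} r → ⊎-× (P⊆ r) (Q⊆ (q x y))) p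
af-binary {C = C} {S} {T} p@(later f) P⊆ q@(later g) Q⊆ = later λ x → af-mono flatten
  (af-unary {C = λ y z → C y z ⊎ (C x y ⊎ S y z × T y z)}
    (af-binary {C = λ y z → C y z ⊎ (C x y ⊎ S x y)} (f x)
      (λ { (inj₁ r) → map₁ inj₁ (P⊆ r) ; (inj₂ r) → inj₁ (inj₂ (P⊆ r)) })
      q (λ r → map₁ inj₁ (Q⊆ r)))
    regroup
    (af-binary {C = λ y z → C y z ⊎ (C x y ⊎ T x y)} p
      (λ r → map₁ inj₁ (P⊆ r))
      (g x) (λ { (inj₁ r) → map₁ inj₁ (Q⊆ r) ; (inj₂ r) → inj₁ (inj₂ (Q⊆ r)) }))
    regroup)

af-× : {A : Set} {R S : A → A → Set} →
       AlmostFull R → AlmostFull S → AlmostFull (λ x y → R x y × S x y)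
af-× r s = af-mono (λ { (inj₁ ()) ; (inj₂ rs) → rs })
  (af-binary {C = λ _ _ → ⊥} r inj₂ s inj₂)

af-≤ : AlmostFull ℕ._≤_
af-≤ = later below
  where
  below : ∀ x → AlmostFull (λ y z → y ℕ.≤ z ⊎ x ℕ.≤ y)
  below zero    = now λ _ _ → inj₂ z≤n
  below (suc x) = later step
    where
    step : ∀ y → AlmostFull (λ z w → (z ℕ.≤ w ⊎ suc x ℕ.≤ z) ⊎ (y ℕ.≤ z ⊎ suc x ℕ.≤ y))
    step y with suc x ℕₚ.≤? y
    ... | yes x<y = now λ _ _ → inj₂ (inj₂ x<y)
    -- Here `y ≤ x`, so whatever lies above `x` lies above `y`, and the derivation for the smaller
    -- bound `x` suffices.
    ... | no  x≮y = af-mono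
      (λ { (inj₁ z≤w) → inj₁ (inj₁ z≤w)
         ; (inj₂ x≤z) → inj₂ (inj₁ (ℕₚ.≤-trans (ℕₚ.≤-pred (ℕₚ.≰⇒> x≮y)) x≤z)) }) (below x)

Counters : ℕ → Set
Counters d = Fin d → ℕ

infix 4 _≼_
_≼_ : ∀ {d} → Counters d → Counters d → Set
v ≼ w = ∀ i → v i ℕ.≤ w i

dickson : ∀ d → AlmostFull (_≼_ {d})
dickson zero    = now λ _ _ ()
dickson (suc d) = af-mono (λ { (h , t) zero → h ; (h , t) (suc i) → t i })
  (af-× (af-comap (λ v → v zero) af-≤) (af-comap (λ v i → v (suc i)) (dickson d)))

-- Fourier-Motzkin elimination

-- A homogeneous linear form in one distinguished variable y and k further variables;
-- the coefficient of y comes last.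
Row : ℕ → Set
Row zero    = ℤ
Row (suc k) = ℤ × Row k

eval : ∀ {k} → Row k → ℕ → Vec ℕ k → ℤ
eval {zero}  a       y _        = a * + y
eval {suc k} (c , r) y (x ∷ xs) = c * + x + eval r y xs

zeroRow : ∀ k → Row k
zeroRow zero    = + 0
zeroRow (suc k) = + 0 , zeroRow k

combine : ∀ {k} → ℤ → Row k → ℤ → Row k → Row k
combine {zero}  α a β b = α * a + β * b
combine {suc k} α (a , r) β (b , s) = α * a + β * b , combine α r β s

eval-zeroRow : ∀ {k} y (xs : Vec ℕ k) → eval (zeroRow k) y xs ≡ + 0
eval-zeroRow {zero}  y xs       = *-zeroˡ (+ y)
eval-zeroRow {suc k} y (x ∷ xs) = cong₂ _+_ (*-zeroˡ (+ x)) (eval-zeroRow y xs)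

private
  regroup₀ : ∀ α a β b y → (α * a + β * b) * y ≡ α * (a * y) + β * (b * y)
  regroup₀ = solve-∀
  regroup₁ : ∀ α a β b x e f →
    (α * a + β * b) * x + (α * e + β * f) ≡ α * (a * x + e) + β * (b * x + f)
  regroup₁ = solve-∀

eval-combine : ∀ {k} α (r : Row k) β s y xs →
  eval (combine α r β s) y xs ≡ α * eval r y xs + β * eval s y xs
eval-combine {zero}  α a β b y xs = regroup₀ α a β b (+ y)
eval-combine {suc k} α (a , r) β (b , s) y (x ∷ xs) =
  trans (cong (λ e → (α * a + β * b) * + x + e) (eval-combine α r β s y xs))
        (regroup₁ α a β b (+ x) (eval r y xs) (eval s y xs))

eval-scale : ∀ {k} m (r : Row k) y xs →
  eval r (m ℕ.* y) (Vec.map (m ℕ.*_) xs) ≡ + m * eval r y xs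
eval-scale {zero} m a y xs =
  trans (cong (a *_) (pos-* m y)) (exchange a (+ m) (+ y))
  where exchange : ∀ a m y → a * (m * y) ≡ m * (a * y)
        exchange = solve-∀
eval-scale {suc k} m (c , r) y (x ∷ xs) =
  trans (cong₂ _+_ (cong (c *_) (pos-* m x)) (eval-scale m r y xs))
        (dist c (+ m) (+ x) (eval r y xs))
  where dist : ∀ c m x e → c * (m * x) + m * e ≡ m * (c * x + e)
        dist = solve-∀

private
  0*x+e : ∀ x e → + 0 * x + e ≡ e
  0*x+e x e = trans (cong (_+ e) (*-zeroˡ x)) (+-identityˡ e)

  scale-nonneg : ∀ n {i} → + 0 ≤ i → + 0 ≤ +[1+ n ] * i
  scale-nonneg n {i} 0≤i = subst (_≤ +[1+ n ] * i) (*-zeroʳ +[1+ n ]) (*-monoˡ-≤-nonNeg +[1+ n ] 0≤i)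

-- The variable `y` homogenises. Requiring only `y ≥ 1` amounts to asking for a nonnegative rational
-- solution at `y = 1` with denominators cleared, so no divisibility conditions arise.
Feasible : ∀ {k} → List (Row k) → Set
Feasible {k} rows =
  ∃ λ y → ∃ λ (xs : Vec ℕ k) → 1 ℕ.≤ y × (∀ {r} → r ∈ rows → + 0 ≤ eval r y xs)

zeros : ∀ {k} → List (Row (suc k)) → List (Row k)
zeros []                      = []
zeros ((+ 0 , r) ∷ rows)      = r ∷ zeros rows
zeros ((+[1+ n ] , r) ∷ rows) = zeros rows
zeros ((-[1+ n ] , r) ∷ rows) = zeros rows

-- Rows with leading coefficient 1 + n, respectively -(1 + n).
lowers uppers : ∀ {k} → List (Row (suc k)) → List (ℕ × Row k)
lowers []                      = []
lowers ((+ 0 , r) ∷ rows)      = lowers rows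
lowers ((+[1+ n ] , r) ∷ rows) = (n , r) ∷ lowers rows
lowers ((-[1+ n ] , r) ∷ rows) = lowers rows
uppers []                      = []
uppers ((+ 0 , r) ∷ rows)      = uppers rows
uppers ((+[1+ n ] , r) ∷ rows) = uppers rows
uppers ((-[1+ n ] , r) ∷ rows) = (n , r) ∷ uppers rows

∈-zeros⁺ : ∀ {k} (rows : List (Row (suc k))) {r} → (+ 0 , r) ∈ rows → r ∈ zeros rows
∈-zeros⁺ ((+ 0 , _) ∷ _)         (here refl) = here refl
∈-zeros⁺ ((+ 0 , _) ∷ rows)      (there m)   = there (∈-zeros⁺ rows m)
∈-zeros⁺ ((+[1+ _ ] , _) ∷ rows) (there m)   = ∈-zeros⁺ rows m
∈-zeros⁺ ((-[1+ _ ] , _) ∷ rows) (there m)   = ∈-zeros⁺ rows m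

∈-zeros⁻ : ∀ {k} (rows : List (Row (suc k))) {r} → r ∈ zeros rows → (+ 0 , r) ∈ rows
∈-zeros⁻ ((+ 0 , _) ∷ _)         (here refl) = here refl
∈-zeros⁻ ((+ 0 , _) ∷ rows)      (there m)   = there (∈-zeros⁻ rows m)
∈-zeros⁻ ((+[1+ _ ] , _) ∷ rows) m           = there (∈-zeros⁻ rows m)
∈-zeros⁻ ((-[1+ _ ] , _) ∷ rows) m           = there (∈-zeros⁻ rows m)

∈-lowers⁺ : ∀ {k} (rows : List (Row (suc k))) {n r} →
            (+[1+ n ] , r) ∈ rows → (n , r) ∈ lowers rows
∈-lowers⁺ ((+[1+ _ ] , _) ∷ _)    (here refl) = here refl
∈-lowers⁺ ((+ 0 , _) ∷ rows)      (there m)   = ∈-lowers⁺ rows m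
∈-lowers⁺ ((+[1+ _ ] , _) ∷ rows) (there m)   = there (∈-lowers⁺ rows m)
∈-lowers⁺ ((-[1+ _ ] , _) ∷ rows) (there m)   = ∈-lowers⁺ rows m

∈-lowers⁻ : ∀ {k} (rows : List (Row (suc k))) {n r} →
            (n , r) ∈ lowers rows → (+[1+ n ] , r) ∈ rows
∈-lowers⁻ ((+ 0 , _) ∷ rows)      m           = there (∈-lowers⁻ rows m)
∈-lowers⁻ ((+[1+ _ ] , _) ∷ _)    (here refl) = here refl
∈-lowers⁻ ((+[1+ _ ] , _) ∷ rows) (there m)   = there (∈-lowers⁻ rows m)
∈-lowers⁻ ((-[1+ _ ] , _) ∷ rows) m           = there (∈-lowers⁻ rows m)

∈-uppers⁺ : ∀ {k} (rows : List (Row (suc k))) {n r} →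
            (-[1+ n ] , r) ∈ rows → (n , r) ∈ uppers rows
∈-uppers⁺ ((-[1+ _ ] , _) ∷ _)    (here refl) = here refl
∈-uppers⁺ ((+ 0 , _) ∷ rows)      (there m)   = ∈-uppers⁺ rows m
∈-uppers⁺ ((+[1+ _ ] , _) ∷ rows) (there m)   = ∈-uppers⁺ rows m
∈-uppers⁺ ((-[1+ _ ] , _) ∷ rows) (there m)   = there (∈-uppers⁺ rows m)

∈-uppers⁻ : ∀ {k} (rows : List (Row (suc k))) {n r} →
            (n , r) ∈ uppers rows → (-[1+ n ] , r) ∈ rows
∈-uppers⁻ ((+ 0 , _) ∷ rows)      m           = there (∈-uppers⁻ rows m)
∈-uppers⁻ ((+[1+ _ ] , _) ∷ rows) m           = there (∈-uppers⁻ rows m)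
∈-uppers⁻ ((-[1+ _ ] , _) ∷ _)    (here refl) = here refl
∈-uppers⁻ ((-[1+ _ ] , _) ∷ rows) (there m)   = there (∈-uppers⁻ rows m)

-- Cross-multiplication cancels the eliminated variable between the rows (1 + n) x + l and -(1 + m)
-- x + u.
resolve : ∀ {k} → ℕ × Row k → ℕ × Row k → Row k
resolve (n , l) (m , u) = combine +[1+ n ] u +[1+ m ] l

-- The row (0 , zeroRow) stands for the constraint that the eliminated variable is nonnegative.
eliminate : ∀ {k} → List (Row (suc k)) → List (Row k)
eliminate rows =
  zeros rows ++ cartesianProductWith resolve ((0 , zeroRow _) ∷ lowers rows) (uppers rows)

eliminate-complete : ∀ {k} (rows : List (Row (suc k))) → Feasible rows → Feasible (eliminate rows)
eliminate-complete {k} rows (y , x ∷ xs , 1≤y , ok) = y , xs , 1≤y , λ r∈ → holds (∈-++⁻ (zeros rows) r∈)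
  where
  lower-ok : ∀ {n l} → (n , l) ∈ (0 , zeroRow k) ∷ lowers rows → + 0 ≤ +[1+ n ] * + x + eval l y xs
  lower-ok (here refl) = subst (+ 0 ≤_)
    (sym (trans (cong₂ _+_ (*-identityˡ (+ x)) (eval-zeroRow y xs)) (+-identityʳ (+ x)))) (+≤+ z≤n)
  lower-ok (there m) = ok (∈-lowers⁻ rows m)
  cancel : ∀ n m x u l → n * (- m * x + u) + m * (n * x + l) ≡ n * u + m * l
  cancel = solve-∀
  holds : ∀ {r} → r ∈ zeros rows ⊎ r ∈ cartesianProductWith resolve ((0 , zeroRow k) ∷ lowers rows) (uppers rows) →
          + 0 ≤ eval r y xs
  holds {r} (inj₁ r∈) = subst (+ 0 ≤_) (0*x+e (+ x) (eval r y xs)) (ok (∈-zeros⁻ rows r∈))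
  holds (inj₂ r∈) with ∈-cartesianProductWith⁻ resolve ((0 , zeroRow k) ∷ lowers rows) (uppers rows) r∈
  ... | (n , l) , (m , u) , l∈ , u∈ , refl = subst (+ 0 ≤_)
    (trans (cancel +[1+ n ] +[1+ m ] (+ x) (eval u y xs) (eval l y xs))
           (sym (eval-combine +[1+ n ] u +[1+ m ] l y xs)))
    (+-mono-≤ (scale-nonneg n (ok (∈-uppers⁻ rows u∈))) (scale-nonneg m (lower-ok l∈)))

-- The eliminated variable takes the largest lower bound - eval l / (1 + n); all other variables
-- are scaled by 1 + n to keep it integral.
eliminate-sound : ∀ {k} (rows : List (Row (suc k))) → Feasible (eliminate rows) → Feasible rows
eliminate-sound {k} rows (y , xs , 1≤y , ok) =
  suc n ℕ.* y , ∣ - ℓ ∣ ∷ Vec.map (suc n ℕ.*_) xs , ℕₚ.*-mono-≤ (s≤s (z≤n {n})) 1≤y , λ {r} → holds r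
  where
  bound : ℕ × Row k → ℚᵘ.ℚᵘ
  bound (n , l) = mkℚᵘ (eval l y xs) n
  best : ℕ × Row k
  best = argmin bound (0 , zeroRow k) (lowers rows)
  n = proj₁ best
  ℓ = eval (proj₂ best) y xs
  best∈ : best ∈ (0 , zeroRow k) ∷ lowers rows
  best∈ with argmin-sel bound (0 , zeroRow k) (lowers rows)
  ... | inj₁ eq = here eq
  ... | inj₂ m  = there m
  -- The row `(0 , zeroRow k)` competes for the minimum with value 0, so the minimum is not
  -- positive.
  -ℓ≥0 : + 0 ≤ - ℓ
  -ℓ≥0 with f[argmin]≤f[⊤] {f = bound} (0 , zeroRow k) (lowers rows)
  ... | *≤* le = neg-mono-≤ (subst₂ _≤_ (*-identityʳ ℓ)
                   (trans (cong (_* + suc n) (eval-zeroRow y xs)) (*-zeroˡ (+ suc n))) le)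
  least : ∀ {m l} → (m , l) ∈ lowers rows → ℓ * + suc m ≤ eval l y xs * + suc n
  least m∈ with All.lookup (f[argmin]≤f[xs] {f = bound} (0 , zeroRow k) (lowers rows)) m∈
  ... | *≤* le = le
  value : ∀ c r → eval (c , r) (suc n ℕ.* y) (∣ - ℓ ∣ ∷ Vec.map (suc n ℕ.*_) xs)
                ≡ c * - ℓ + + suc n * eval r y xs
  value c r = cong₂ _+_ (cong (c *_) (0≤i⇒+∣i∣≡i -ℓ≥0)) (eval-scale (suc n) r y xs)
  holds : ∀ r → r ∈ rows → + 0 ≤ eval r (suc n ℕ.* y) (∣ - ℓ ∣ ∷ Vec.map (suc n ℕ.*_) xs)
  holds (+ 0 , r) r∈ = subst (+ 0 ≤_)
    (sym (trans (value (+ 0) r) (0*x+e (- ℓ) (+ suc n * eval r y xs))))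
    (scale-nonneg n (ok (∈-++⁺ˡ (∈-zeros⁺ rows r∈))))
  holds (+[1+ m ] , r) r∈ = subst (+ 0 ≤_)
    (trans (rearrange ℓ +[1+ m ] (eval r y xs) (+ suc n)) (sym (value +[1+ m ] r)))
    (i≤j⇒0≤j-i (least (∈-lowers⁺ rows r∈)))
    where rearrange : ∀ ℓ m e n → e * n + - (ℓ * m) ≡ m * - ℓ + n * e
          rearrange = solve-∀
  holds (-[1+ m ] , r) r∈ = subst (+ 0 ≤_)
    (trans (eval-combine +[1+ n ] r +[1+ m ] (proj₂ best) y xs)
      (trans (rearrange ℓ +[1+ m ] (eval r y xs) (+ suc n)) (sym (value -[1+ m ] r))))
    (ok (∈-++⁺ʳ (zeros rows) (∈-cartesianProductWith⁺ resolve best∈ (∈-uppers⁺ rows r∈))))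
    where rearrange : ∀ ℓ m e n → n * e + m * ℓ ≡ - m * - ℓ + n * e
          rearrange = solve-∀

feasible? : ∀ {k} (rows : List (Row k)) → Dec (Feasible rows)
feasible? {zero} rows = map′
  (λ ok → 1 , [] , s≤s z≤n , λ {r} r∈ → subst (+ 0 ≤_) (sym (*-identityʳ r)) (All.lookup ok r∈))
  (λ { (suc y , [] , _ , ok) → All.tabulate λ {a} a∈ →
         *-cancelʳ-≤-pos (+ 0) a +[1+ y ] (subst (_≤ a * +[1+ y ]) (sym (*-zeroˡ +[1+ y ])) (ok a∈)) })
  (all? (+ 0 ≤?_) rows)
feasible? {suc k} rows =
  map′ (eliminate-sound rows) (eliminate-complete rows) (feasible? (eliminate rows))

-- Semilinear sets

Update : ℕ → Set
Update d = Fin d → ℤ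

infix 4 _⊑_
_⊑_ : ∀ {d} → Update d → Update d → Set
x ⊑ y = ∀ i → x i ≤ y i

⊑-refl : ∀ {d} {x : Update d} → x ⊑ x
⊑-refl _ = ≤-refl

⊑-trans : ∀ {d} {x y z : Update d} → x ⊑ y → y ⊑ z → x ⊑ z
⊑-trans p q i = ≤-trans (p i) (q i)

infixl 6 _⊕_
_⊕_ : ∀ {d} → Update d → Update d → Update d
(x ⊕ y) i = x i + y i

⊕-mono : ∀ {d} {x x′ y y′ : Update d} → x ⊑ x′ → y ⊑ y′ → x ⊕ y ⊑ x′ ⊕ y′
⊕-mono p q i = +-mono-≤ (p i) (q i)

⊕-assoc : ∀ {d} (x y z : Update d) → (x ⊕ y) ⊕ z ⊑ x ⊕ (y ⊕ z)
⊕-assoc x y z i = ≤-reflexive (+-assoc (x i) (y i) (z i))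

⊕-assoc′ : ∀ {d} (x y z : Update d) → x ⊕ (y ⊕ z) ⊑ (x ⊕ y) ⊕ z
⊕-assoc′ x y z i = ≤-reflexive (sym (+-assoc (x i) (y i) (z i)))

⊕-comm : ∀ {d} (x y : Update d) → x ⊕ y ⊑ y ⊕ x
⊕-comm x y i = ≤-reflexive (+-comm (x i) (y i))

𝟘 : ∀ {d} → Update d
𝟘 _ = + 0

Linear Semilinear : ℕ → Set
Linear d     = Update d × List (Update d)
Semilinear d = List (Linear d)

infix 4 _∈ₗ_ _∈ₛ_
-- The downward closure of b + ℕ p₁ + ⋯ + ℕ pₖ.
data _∈ₗ_ {d} (x : Update d) (l : Linear d) : Set where
  base : x ⊑ proj₁ l → x ∈ₗ l
  more : ∀ {p y} → p ∈ proj₂ l → y ∈ₗ l → x ⊑ y ⊕ p → x ∈ₗ l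

∈ₗ-down : ∀ {d} {x y : Update d} {l} → x ⊑ y → y ∈ₗ l → x ∈ₗ l
∈ₗ-down x⊑y (base q)     = base (⊑-trans x⊑y q)
∈ₗ-down x⊑y (more p m q) = more p m (⊑-trans x⊑y q)

_∈ₛ_ : ∀ {d} → Update d → Semilinear d → Set
x ∈ₛ S = ∃ λ l → l ∈ S × x ∈ₗ l

∈ₛ-down : ∀ {d} {x y : Update d} {S} → x ⊑ y → y ∈ₛ S → x ∈ₛ S
∈ₛ-down x⊑y (l , l∈ , y∈) = l , l∈ , ∈ₗ-down x⊑y y∈

∈ₛ-++ˡ : ∀ {d} {x : Update d} {S T} → x ∈ₛ S → x ∈ₛ S ++ T
∈ₛ-++ˡ (l , l∈ , x∈) = l , ∈-++⁺ˡ l∈ , x∈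

∈ₛ-++ʳ : ∀ {d} {x : Update d} S {T} → x ∈ₛ T → x ∈ₛ S ++ T
∈ₛ-++ʳ S (l , l∈ , x∈) = l , ∈-++⁺ʳ S l∈ , x∈

∈ₛ-++⁻ : ∀ {d} {x : Update d} S {T} → x ∈ₛ S ++ T → x ∈ₛ S ⊎ x ∈ₛ T
∈ₛ-++⁻ S (l , l∈ , x∈) with ∈-++⁻ S l∈
... | inj₁ m = inj₁ (l , m , x∈)
... | inj₂ m = inj₂ (l , m , x∈)

infixl 7 _·ₗ_ _·_
_·ₗ_ : ∀ {d} → Linear d → Linear d → Linear d
(b , P) ·ₗ (c , R) = b ⊕ c , P ++ R

_·_ : ∀ {d} → Semilinear d → Semilinear d → Semilinear d
_·_ = cartesianProductWith _·ₗ_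

swap-last : ∀ a b c → (a + b) + c ≡ (a + c) + b
swap-last = solve-∀

⊕-swap-last : ∀ {d} (x y z : Update d) → (x ⊕ y) ⊕ z ⊑ (x ⊕ z) ⊕ y
⊕-swap-last x y z i = ≤-reflexive (swap-last (x i) (y i) (z i))

·ₗ⁺ : ∀ {d} {x y z : Update d} {l m} → x ∈ₗ l → y ∈ₗ m → z ⊑ x ⊕ y → z ∈ₗ l ·ₗ m
·ₗ⁺ (base p) (base q) r = base (⊑-trans r (⊕-mono p q))
·ₗ⁺ {x = x} {l = l} x∈@(base _) (more {p} {y′} p∈ y∈ q) r =
  more (∈-++⁺ʳ (proj₂ l) p∈) (·ₗ⁺ x∈ y∈ ⊑-refl)
    (⊑-trans r (⊑-trans (⊕-mono (⊑-refl {x = x}) q) (⊕-assoc′ x y′ p)))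
·ₗ⁺ {y = y} (more {p} {x′} p∈ x∈ q) y∈ r =
  more (∈-++⁺ˡ p∈) (·ₗ⁺ x∈ y∈ ⊑-refl)
    (⊑-trans r (⊑-trans (⊕-mono q (⊑-refl {x = y})) (⊕-swap-last x′ p y)))

·ₗ⁻ : ∀ {d} {z : Update d} l m → z ∈ₗ l ·ₗ m → ∃₂ λ x y → x ∈ₗ l × y ∈ₗ m × z ⊑ x ⊕ y
·ₗ⁻ l m (base q) = proj₁ l , proj₁ m , base ⊑-refl , base ⊑-refl , q
·ₗ⁻ l m (more {p} {w} p∈ w∈ q) with ·ₗ⁻ l m w∈ | ∈-++⁻ (proj₂ l) p∈
... | x , y , x∈ , y∈ , r | inj₁ p∈l = x ⊕ p , y , more p∈l x∈ ⊑-refl , y∈ ,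
  ⊑-trans q (⊑-trans (⊕-mono r (⊑-refl {x = p})) (⊕-swap-last x y p))
... | x , y , x∈ , y∈ , r | inj₂ p∈m = x , y ⊕ p , x∈ , more p∈m y∈ ⊑-refl ,
  ⊑-trans q (⊑-trans (⊕-mono r (⊑-refl {x = p})) (⊕-assoc x y p))

·⁺ : ∀ {d} {x y z : Update d} {S T} → x ∈ₛ S → y ∈ₛ T → z ⊑ x ⊕ y → z ∈ₛ S · T
·⁺ (l , l∈ , x∈) (m , m∈ , y∈) r = l ·ₗ m , ∈-cartesianProductWith⁺ _·ₗ_ l∈ m∈ , ·ₗ⁺ x∈ y∈ r

·⁻ : ∀ {d} {z : Update d} S T → z ∈ₛ S · T → ∃₂ λ x y → x ∈ₛ S × y ∈ₛ T × z ⊑ x ⊕ y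
·⁻ S T (_ , n∈ , z∈) with ∈-cartesianProductWith⁻ _·ₗ_ S T n∈
... | l , m , l∈ , m∈ , refl with ·ₗ⁻ l m z∈
... | x , y , x∈ , y∈ , r = x , y , (l , l∈ , x∈) , (m , m∈ , y∈) , r

-- Sums of at least one element of b + ℕ P.
iterate⁺ : ∀ {d} → Linear d → Linear d
iterate⁺ (b , P) = b , b ∷ P

-- As addition is commutative, the summands from `l` can be collected first. Either there is none,
-- or together they lie in `iterate⁺ l`; the periods of `l` are available only in the second case.
star : ∀ {d} → Semilinear d → Semilinear d
star []      = (𝟘 , []) ∷ []
star (l ∷ S) = star S ++ (iterate⁺ l ∷ []) · star S

𝟘∈star : ∀ {d} (S : Semilinear d) → 𝟘 ∈ₛ star S
𝟘∈star []      = (𝟘 , []) , here refl , base ⊑-refl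
𝟘∈star (l ∷ S) = ∈ₛ-++ˡ (𝟘∈star S)

iterate⁺-one : ∀ {d} {x : Update d} {l} → x ∈ₗ l → x ∈ₗ iterate⁺ l
iterate⁺-one (base q)      = base q
iterate⁺-one (more p∈ m q) = more (there p∈) (iterate⁺-one m) q

iterate⁺-add : ∀ {d} {x y z : Update d} {l} → x ∈ₗ l → y ∈ₗ iterate⁺ l → z ⊑ x ⊕ y → z ∈ₗ iterate⁺ l
iterate⁺-add {x = x} {y} (base q) y∈ r =
  more (here refl) y∈ (⊑-trans r (⊑-trans (⊕-comm x y) (⊕-mono (⊑-refl {x = y}) q)))
iterate⁺-add {y = y} (more {p} {x′} p∈ x∈ q) y∈ r =
  more (there p∈) (iterate⁺-add x∈ y∈ ⊑-refl)
    (⊑-trans r (⊑-trans (⊕-mono q (⊑-refl {x = y})) (⊕-swap-last x′ p y)))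

⊕-exchange : ∀ {d} (x y z : Update d) → x ⊕ (y ⊕ z) ⊑ y ⊕ (x ⊕ z)
⊕-exchange x y z i = ≤-reflexive (exchange (x i) (y i) (z i))
  where exchange : ∀ a b c → a + (b + c) ≡ b + (a + c)
        exchange = solve-∀

x⊑x⊕𝟘 : ∀ {d} {x : Update d} → x ⊑ x ⊕ 𝟘
x⊑x⊕𝟘 {x = x} i = ≤-reflexive (sym (+-identityʳ (x i)))

𝟘⊕x⊑x : ∀ {d} {x : Update d} → 𝟘 ⊕ x ⊑ x
𝟘⊕x⊑x {x = x} i = ≤-reflexive (+-identityˡ (x i))

star-add : ∀ {d} {x y z : Update d} S → x ∈ₛ S → y ∈ₛ star S → z ⊑ x ⊕ y → z ∈ₛ star S
star-add {x = x} {y} (l ∷ S) (_ , l∈ , x∈) y∈ r with ∈ₛ-++⁻ (star S) y∈ | l∈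
... | inj₁ y∈ | here refl =
  ∈ₛ-++ʳ (star S) (·⁺ {S = iterate⁺ l ∷ []} (iterate⁺ l , here refl , iterate⁺-one x∈) y∈ r)
... | inj₁ y∈ | there l∈  = ∈ₛ-++ˡ (star-add S (_ , l∈ , x∈) y∈ r)
... | inj₂ y∈ | l∈′ with ·⁻ (iterate⁺ l ∷ []) (star S) y∈
star-add {x = x} (l ∷ S) (_ , l∈ , x∈) y∈ r | inj₂ _ | here refl
    | y₁ , y₂ , (_ , here refl , y₁∈) , y₂∈ , q =
  ∈ₛ-++ʳ (star S) (·⁺ {S = iterate⁺ l ∷ []} (iterate⁺ l , here refl , iterate⁺-add x∈ y₁∈ ⊑-refl) y₂∈
    (⊑-trans r (⊑-trans (⊕-mono (⊑-refl {x = x}) q) (⊕-assoc′ x y₁ y₂))))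
star-add {x = x} (l ∷ S) (_ , l∈ , x∈) y∈ r | inj₂ _ | there l∈′
    | y₁ , y₂ , y₁∈ , y₂∈ , q =
  ∈ₛ-++ʳ (star S) (·⁺ {S = iterate⁺ l ∷ []} y₁∈ (star-add S (_ , l∈′ , x∈) y₂∈ ⊑-refl)
    (⊑-trans r (⊑-trans (⊕-mono (⊑-refl {x = x}) q) (⊕-exchange x y₁ y₂))))

-- The model is the set of effects of closed walks at a fixed vertex, where `add` is concatenation.
-- Soundness of `star` and `rows` is proved against any such predicate.
record Additive {d} (Φ : Update d → Set) : Set where
  field
    down : ∀ {x y} → x ⊑ y → Φ y → Φ x
    add  : ∀ {x y} → Φ x → Φ y → Φ (x ⊕ y)
open Additive

-- One element `y` of `l` takes all its periods, and `z` consists of the further copies of the base.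
-- When there are no further copies, `z` is reported as `z ⊑ 𝟘` instead of through `Φ`.
iterate⁺-sound : ∀ {d} {Φ : Update d → Set} → Additive Φ → ∀ l →
  (∀ {x} → x ∈ₗ l → Φ x) → ∀ {x} → x ∈ₗ iterate⁺ l →
  ∃₂ λ y z → y ∈ₗ l × (Φ z ⊎ z ⊑ 𝟘) × x ⊑ y ⊕ z
iterate⁺-sound Φ+ l l⊆Φ (base q) = _ , 𝟘 , base q , inj₂ ⊑-refl , x⊑x⊕𝟘
iterate⁺-sound Φ+ l l⊆Φ (more (there {_} {_} p∈) x∈ q) with iterate⁺-sound Φ+ l l⊆Φ x∈
... | y , z , y∈ , Φz , r = _ , z , more p∈ y∈ ⊑-refl , Φz ,
  ⊑-trans q (⊑-trans (⊕-mono r ⊑-refl) (⊕-swap-last y z _))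
iterate⁺-sound Φ+ l l⊆Φ (more (here refl) x∈ q) with iterate⁺-sound Φ+ l l⊆Φ x∈
... | y , z , y∈ , inj₁ Φz , r = y , z ⊕ proj₁ l , y∈ , inj₁ (add Φ+ Φz (l⊆Φ (base ⊑-refl))) ,
  ⊑-trans q (⊑-trans (⊕-mono r ⊑-refl) (⊕-assoc y z _))
... | y , z , y∈ , inj₂ z⊑𝟘 , r = y , proj₁ l , y∈ , inj₁ (l⊆Φ (base ⊑-refl)) ,
  ⊑-trans q (⊕-mono (⊑-trans r (⊑-trans (⊕-mono (⊑-refl {x = y}) z⊑𝟘)
    λ i → ≤-reflexive (+-identityʳ (y i)))) ⊑-refl)

star-sound : ∀ {d} {Φ : Update d → Set} → Additive Φ → Φ 𝟘 → ∀ S →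
  (∀ {x} → x ∈ₛ S → Φ x) → ∀ {x} → x ∈ₛ star S → Φ x
star-sound Φ+ Φ𝟘 [] S⊆Φ (_ , here refl , base q) = down Φ+ q Φ𝟘
star-sound Φ+ Φ𝟘 (l ∷ S) S⊆Φ x∈ with ∈ₛ-++⁻ (star S) x∈
... | inj₁ x∈ = star-sound Φ+ Φ𝟘 S (λ { (m , m∈ , x∈) → S⊆Φ (m , there m∈ , x∈) }) x∈
... | inj₂ x∈ with ·⁻ (iterate⁺ l ∷ []) (star S) x∈
... | y , z , (_ , here refl , y∈) , z∈ , r
  with iterate⁺-sound Φ+ l (λ {x} x∈ → S⊆Φ (l , here refl , x∈)) y∈
... | u , w , u∈ , Φw , q = down Φ+ (⊑-trans r (⊕-mono q ⊑-refl))
  (add Φ+ (add Φ+ (S⊆Φ (l , here refl , u∈)) (weak Φw))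
    (star-sound Φ+ Φ𝟘 S (λ { (m , m∈ , x∈) → S⊆Φ (m , there m∈ , x∈) }) z∈))
  where weak : _ → _
        weak (inj₁ Φw)  = Φw
        weak (inj₂ w⊑𝟘) = down Φ+ w⊑𝟘 Φ𝟘

-- The elements whose addition preserves `star S` form an additive predicate that contains `𝟘` and
-- `S`; by `star-sound` it contains all of `star S`.
star-star : ∀ {d} {x y z : Update d} S → x ∈ₛ star S → y ∈ₛ star S → z ⊑ x ⊕ y → z ∈ₛ star S
star-star S x∈ y∈ r = star-sound
  {Φ = λ x → ∀ {y z} → y ∈ₛ star S → z ⊑ x ⊕ y → z ∈ₛ star S}
  (record { down = λ p Φy y∈ r → Φy y∈ (⊑-trans r (⊕-mono p ⊑-refl))
          ; add  = λ {x} {x′} Φx Φx′ {y} y∈ r → Φx (Φx′ y∈ ⊑-refl) (⊑-trans r (⊕-assoc x x′ y)) })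
  (λ y∈ r → ∈ₛ-down (⊑-trans r 𝟘⊕x⊑x) y∈) S (λ x∈ y∈ r → star-add S x∈ y∈ r) x∈ y∈ r

-- Coordinate `i` of y b + x₁ p₁ + ⋯ + xₖ pₖ as a linear form in the multiplicities; the base
-- becomes the coefficient of the homogenising variable.
rowAt : ∀ {d} → Update d → (P : List (Update d)) → Fin d → Row (length P)
rowAt b []      i = b i
rowAt b (p ∷ P) i = p i , rowAt b P i

rows : ∀ {d} (l : Linear d) → List (Row (length (proj₂ l)))
rows (b , P) = map (rowAt b P) (allFin _)

bump : ∀ {A : Set} {p : A} {P} → p ∈ P → Vec ℕ (length P) → Vec ℕ (length P)
bump (here _)   (x ∷ xs) = suc x ∷ xs
bump (there p∈) (x ∷ xs) = x ∷ bump p∈ xs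

mul-suc : ∀ a x e → a * (+ 1 + x) + e ≡ (a * x + e) + a
mul-suc = solve-∀

eval-bump : ∀ {d} (b : Update d) P {p} (p∈ : p ∈ P) i y xs →
  eval (rowAt b P i) y (bump p∈ xs) ≡ eval (rowAt b P i) y xs + p i
eval-bump b (p ∷ P) (here refl) i y (x ∷ xs) = mul-suc (p i) (+ x) _
eval-bump b (q ∷ P) (there p∈) i y (x ∷ xs) =
  trans (cong (λ e → q i * + x + e) (eval-bump b P p∈ i y xs)) (sym (+-assoc (q i * + x) _ _))

eval-zeros : ∀ {d} (b : Update d) P i → eval (rowAt b P i) 1 (Vec.replicate (length P) 0) ≡ b i
eval-zeros b []      i = *-identityʳ (b i)
eval-zeros b (p ∷ P) i = trans (cong₂ _+_ (*-zeroʳ (p i)) (eval-zeros b P i)) (+-identityˡ (b i))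

eval-suc : ∀ {d} (b : Update d) P i y xs →
  eval (rowAt b P i) (suc y) xs ≡ eval (rowAt b P i) y xs + b i
eval-suc b []      i y xs       = one (b i) (+ y)
  where one : ∀ a y → a * (+ 1 + y) ≡ a * y + a
        one = solve-∀
eval-suc b (p ∷ P) i y (x ∷ xs) =
  trans (cong (λ e → p i * + x + e) (eval-suc b P i y xs)) (sym (+-assoc (p i * + x) _ _))

coefficients : ∀ {d} {x : Update d} (l : Linear d) → x ∈ₗ l →
  ∃ λ xs → x ⊑ λ i → eval (rowAt (proj₁ l) (proj₂ l) i) 1 xs
coefficients (b , P) (base q) =
  _ , λ i → ≤-trans (q i) (≤-reflexive (sym (eval-zeros b P i)))
coefficients (b , P) (more {p} p∈ y∈ q) with coefficients (b , P) y∈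
... | xs , r = bump p∈ xs , λ i →
  ≤-trans (q i) (≤-trans (+-monoˡ-≤ (p i) (r i)) (≤-reflexive (sym (eval-bump b P p∈ i 1 xs))))

span : ∀ {d} (l : Linear d) (b : Update d) P → (∀ {p} → p ∈ P → p ∈ proj₂ l) → b ∈ₗ l → ∀ xs →
  (λ i → eval (rowAt b P i) 1 xs) ∈ₗ l
span l b []      P⊆ b∈ xs = ∈ₗ-down (λ i → ≤-reflexive (*-identityʳ (b i))) b∈
span l b (p ∷ P) P⊆ b∈ (x ∷ xs) = times x
  where
  times : ∀ x → (λ i → eval (rowAt b (p ∷ P) i) 1 (x ∷ xs)) ∈ₗ l
  times zero = ∈ₗ-down
    (λ i → ≤-reflexive (trans (cong (λ e → e + eval (rowAt b P i) 1 xs) (*-zeroʳ (p i))) (+-identityˡ _)))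
    (span l b P (λ p∈ → P⊆ (there p∈)) b∈ xs)
  times (suc x) = more (P⊆ (here refl)) (times x)
    λ i → ≤-reflexive (mul-suc (p i) (+ x) (eval (rowAt b P i) 1 xs))

rows-complete : ∀ {d} (l : Linear d) {x} → 𝟘 ⊑ x → x ∈ₗ l → Feasible (rows l)
rows-complete (b , P) 0⊑x x∈ with coefficients (b , P) x∈
... | xs , r = 1 , xs , s≤s z≤n , λ {s} s∈ → go (∈-map⁻ (rowAt b P) s∈)
  where go : ∀ {s} → (∃ λ i → i ∈ allFin _ × s ≡ rowAt b P i) → + 0 ≤ eval s 1 xs
        go (i , _ , refl) = ≤-trans (0⊑x i) (r i)

-- A solution with `y > 1` describes a sum of `y` elements of `l` rather than a single one.
-- Additivity makes up for this: for closed walks, several of them are run through in succession.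
rows-sound : ∀ {d} {Φ : Update d → Set} → Additive Φ → (l : Linear d) →
  (∀ {x} → x ∈ₗ l → Φ x) → Feasible (rows l) → Φ 𝟘
rows-sound {Φ = Φ} Φ+ l@(b , P) l⊆Φ (suc y , xs , _ , ok) =
  down Φ+ (λ i → ok (∈-map⁺ (rowAt b P) (∈-allFin i))) (multiple y)
  where
  multiple : ∀ y → Φ (λ i → eval (rowAt b P i) (suc y) xs)
  multiple zero    = l⊆Φ (span l b P (λ p∈ → p∈) (base ⊑-refl) xs)
  multiple (suc y) = down Φ+ (λ i → ≤-reflexive (eval-suc b P i (suc y) xs))
    (add Φ+ (multiple y) (l⊆Φ (base ⊑-refl)))

-- Energy games and their one-player case

uniform : {A : Set} (P : A → ℕ → Set) → (∀ {x m n} → m ℕ.≤ n → P x m → P x n) →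
  ∀ xs → (∀ {x} → x ∈ xs → ∃ (P x)) → ∃ λ N → ∀ {x} → x ∈ xs → P x N
uniform P up []       h = 0 , λ ()
uniform P up (x ∷ xs) h with h (here refl) | uniform P up xs (λ x∈ → h (there x∈))
... | m , Pm | n , Pn = m ℕ.+ n , λ
  { (here refl) → up (ℕₚ.m≤m+n m n) Pm ; (there x∈) → up (ℕₚ.m≤n+m n m) (Pn x∈) }

absorb : ∀ z → + 0 ≤ + ∣ z ∣ + z
absorb (+ n)      = +≤+ z≤n
absorb (-[1+ n ]) = ≤-reflexive (sym (+-inverseʳ +[1+ n ]))

record Finite (Q : Set) : Set where
  field
    elements : List Q
    complete : ∀ q → q ∈ elements
    _≟_      : (p q : Q) → Dec (p ≡ q)

record Game (d : ℕ) (Q : Set) : Set where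
  field
    owns  : Q → Owner
    edges : Q → List (Update d × Q)
open Game

-- Counters may drop spontaneously during a step; this makes winning monotone by construction.
Fits : ∀ {d} → Counters d → Update d → Counters d → Set
Fits v z v′ = ∀ i → + v′ i ≤ + v i + z i

-- Player 1 can force a position in which the opponent has no step keeping the counters in ℕ.
data Wins {d Q} (G : Game d Q) (q : Q) (v : Counters d) : Set where
  force : owns G q ≡ player1 → ∀ {z q′} → (z , q′) ∈ edges G q →
           (∀ {v′} → Fits v z v′ → Wins G q′ v′) → Wins G q v
  suffer : owns G q ≡ prob →
           (∀ {z q′} → (z , q′) ∈ edges G q → ∀ {v′} → Fits v z v′ → Wins G q′ v′) → Wins G q v

fits-mono : ∀ {d} {v w : Counters d} z {v′} → w ≼ v → Fits w z v′ → Fits v z v′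
fits-mono z w≼v fits i = ≤-trans (fits i) (+-monoˡ-≤ (z i) (+≤+ (w≼v i)))

wins-mono : ∀ {d Q} {G : Game d Q} {q v w} → w ≼ v → Wins G q v → Wins G q w
wins-mono w≼v (force o {z} e∈ h) = force o e∈ λ fits → h (fits-mono z w≼v fits)
wins-mono w≼v (suffer o h)        = suffer o λ {z} e∈ fits → h e∈ (fits-mono z w≼v fits)

-- The unknown initial credit problem at `q`, with `N` a sufficient credit for the opponent whenever
-- any credit suffices.
Decided : ∀ {d Q} → Game d Q → Q → ℕ → Set
Decided G q N = ¬ Wins G q (λ _ → N) ⊎ (∀ v → Wins G q v)

Solvable : ∀ {d Q} → Game d Q → Set
Solvable G = ∃ λ N → ∀ q → Decided G q N

decided-up : ∀ {d Q} {G : Game d Q} {q m n} → m ℕ.≤ n → Decided G q m → Decided G q n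
decided-up m≤n (inj₁ ¬w) = inj₁ λ w → ¬w (wins-mono (λ _ → m≤n) w)
decided-up m≤n (inj₂ w)  = inj₂ w

-- The recorded effect is any lower bound of the sum along the walk, in accordance with dropping
-- counters and with the downward closed sets of `_∈ₛ_`.
data Walk {d Q} (f : Q → List (Update d × Q)) (u : Q) : Q → ℕ → Update d → Set where
  nil  : ∀ {x} → x ⊑ 𝟘 → Walk f u u 0 x
  cons : ∀ {z w v n x y} → (z , w) ∈ f u → Walk f w v n y → x ⊑ z ⊕ y → Walk f u v (suc n) x

walk-down : ∀ {d Q} {f : Q → List (Update d × Q)} {u v n x y} → x ⊑ y → Walk f u v n y → Walk f u v n x
walk-down p (nil q)       = nil (⊑-trans p q)
walk-down p (cons e∈ w q) = cons e∈ w (⊑-trans p q)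

walk-++ : ∀ {d Q} {f : Q → List (Update d × Q)} {u v w m n x y} →
  Walk f u v m x → Walk f v w n y → Walk f u w (m ℕ.+ n) (x ⊕ y)
walk-++ {y = y} (nil p) w = walk-down (⊑-trans (⊕-mono p ⊑-refl) (𝟘⊕x⊑x)) w
walk-++ {y = y} (cons {z} {y = y′} e∈ w p) w′ =
  cons e∈ (walk-++ w w′) (⊑-trans (⊕-mono p (⊑-refl {x = y})) (⊕-assoc z y′ y))

module _ {d : ℕ} {Q : Set} (finite : Finite Q) (f : Q → List (Update d × Q)) where
  open Finite finite

  Walk⁺ : Q → Q → Update d → Set
  Walk⁺ u v x = ∃ λ n → Walk f u v (suc n) x

  -- Kleene's algorithm: effects of the nonempty walks whose inner vertices are among the given ones.
  effects : List Q → Q → Q → Semilinear d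
  effects []       u v = map (λ e → proj₁ e , []) (filter (λ e → proj₂ e ≟ v) (f u))
  effects (k ∷ ks) u v =
    effects ks u v ++ (effects ks u k · star (effects ks k k)) · effects ks k v

  edge∈effects : ∀ ks {u z v} → (z , v) ∈ f u → z ∈ₛ effects ks u v
  edge∈effects [] {v = v} e∈ =
    _ , ∈-map⁺ (λ e → proj₁ e , []) (∈-filter⁺ (λ e → proj₂ e ≟ v) e∈ refl) , base ⊑-refl
  edge∈effects (k ∷ ks) e∈ = ∈ₛ-++ˡ (edge∈effects ks e∈)

  effects-sound : ∀ ks {u v x} → x ∈ₛ effects ks u v → Walk⁺ u v x
  effects-sound [] {u} {v} (_ , l∈ , x∈) with ∈-map⁻ (λ e → proj₁ e , []) l∈
  ... | (z , w) , e∈ , refl with ∈-filter⁻ (λ e → proj₂ e ≟ v) {xs = f u} e∈ | x∈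
  ... | e∈ , refl | base q = 0 , cons e∈ (nil ⊑-refl) (⊑-trans q x⊑x⊕𝟘)
  effects-sound (k ∷ ks) {u} {v} x∈ with ∈ₛ-++⁻ (effects ks u v) x∈
  ... | inj₁ x∈ = effects-sound ks x∈
  ... | inj₂ x∈ with ·⁻ (effects ks u k · star (effects ks k k)) (effects ks k v) x∈
  ... | y , c , y∈ , c∈ , p with ·⁻ (effects ks u k) (star (effects ks k k)) y∈
  ... | a , s , a∈ , s∈ , q with effects-sound ks a∈ | effects-sound ks c∈
      | star-sound {Φ = λ x → ∃ λ n → Walk f k k n x}
          (record { down = λ { p (n , w) → n , walk-down p w }
                  ; add = λ { (m , w) (n , w′) → m ℕ.+ n , walk-++ w w′ } })
          (0 , nil ⊑-refl) (effects ks k k) (λ x∈ → let n , w = effects-sound ks x∈ in suc n , w) s∈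
  ... | _ , w | _ , w″ | _ , w′ =
    _ , walk-down (⊑-trans p (⊕-mono q ⊑-refl)) (walk-++ (walk-++ w w′) w″)

  private
    -- If the walk also ends in `k`, its final segment from `k` to `k` is one more loop and goes
    -- into the star; `right` does the same for walks that start in `k`.
    left : ∀ k ks {u x} → x ∈ₛ effects (k ∷ ks) u k →
      x ∈ₛ effects ks u k · star (effects ks k k)
    left k ks {u} x∈ with ∈ₛ-++⁻ (effects ks u k) x∈
    ... | inj₁ x∈ = ·⁺ x∈ (𝟘∈star (effects ks k k)) x⊑x⊕𝟘
    ... | inj₂ x∈ with ·⁻ (effects ks u k · star (effects ks k k)) (effects ks k k) x∈
    ... | y , c , y∈ , c∈ , p with ·⁻ (effects ks u k) (star (effects ks k k)) y∈
    ... | a , s , a∈ , s∈ , q =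
      ·⁺ a∈ (star-add (effects ks k k) c∈ s∈ (⊕-comm s c))
        (⊑-trans p (⊑-trans (⊕-mono q ⊑-refl) (⊕-assoc a s c)))

    right : ∀ k ks {v y} → y ∈ₛ effects (k ∷ ks) k v →
      ∃₂ λ s c → s ∈ₛ star (effects ks k k) × c ∈ₛ effects ks k v × y ⊑ s ⊕ c
    right k ks {v} y∈ with ∈ₛ-++⁻ (effects ks k v) y∈
    ... | inj₁ y∈ = 𝟘 , _ , 𝟘∈star (effects ks k k) , y∈ , λ i → ≤-reflexive (sym (+-identityˡ _))
    ... | inj₂ y∈ with ·⁻ (effects ks k k · star (effects ks k k)) (effects ks k v) y∈
    ... | y′ , c , y′∈ , c∈ , p with ·⁻ (effects ks k k) (star (effects ks k k)) y′∈
    ... | a , s , a∈ , s∈ , q =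
      y′ , c , star-add (effects ks k k) a∈ s∈ q , c∈ , p

  -- Induction on the inner vertices, with cases according to which of the two walks passes through
  -- `k`. If both do, the segment from `k` through `j` back to `k` becomes a loop counted by the
  -- star.
  effects-trans : ∀ ks {u j v x y z} → j ∈ ks → x ∈ₛ effects ks u j → y ∈ₛ effects ks j v →
    z ⊑ x ⊕ y → z ∈ₛ effects ks u v
  effects-trans (k ∷ ks) {u} {v = v} (here refl) x∈ y∈ r
    with ·⁻ (effects ks u k) (star (effects ks k k)) (left k ks x∈) | right k ks y∈
  ... | a , s , a∈ , s∈ , p | s′ , c , s′∈ , c∈ , q = ∈ₛ-++ʳ (effects ks u v)
    (·⁺ (·⁺ a∈ (star-star (effects ks k k) s∈ s′∈ ⊑-refl) ⊑-refl) c∈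
      (⊑-trans r (⊑-trans (⊕-mono p q) λ i → ≤-reflexive (regroup₄ (a i) (s i) (s′ i) (c i)))))
    where regroup₄ : ∀ a s s′ c → (a + s) + (s′ + c) ≡ (a + (s + s′)) + c
          regroup₄ = solve-∀
  effects-trans (k ∷ ks) {u} {j} {v} (there j∈) x∈ y∈ r
    with ∈ₛ-++⁻ (effects ks u j) x∈ | ∈ₛ-++⁻ (effects ks j v) y∈
  ... | inj₁ x∈ | inj₁ y∈ = ∈ₛ-++ˡ (effects-trans ks j∈ x∈ y∈ r)
  effects-trans (k ∷ ks) {u} {j} {v} {x} (there j∈) _ _ r | inj₁ x∈ | inj₂ y∈
    with ·⁻ (effects ks j k · star (effects ks k k)) (effects ks k v) y∈
  ... | y′ , c , y′∈ , c∈ , p with ·⁻ (effects ks j k) (star (effects ks k k)) y′∈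
  ... | a , s , a∈ , s∈ , q = ∈ₛ-++ʳ (effects ks u v)
    (·⁺ (·⁺ (effects-trans ks j∈ x∈ a∈ ⊑-refl) s∈ ⊑-refl) c∈
      (⊑-trans r (⊑-trans (⊕-mono (⊑-refl {x = x}) (⊑-trans p (⊕-mono q ⊑-refl)))
        λ i → ≤-reflexive (regroup₄ (x i) (a i) (s i) (c i)))))
    where regroup₄ : ∀ x a s c → x + ((a + s) + c) ≡ ((x + a) + s) + c
          regroup₄ = solve-∀
  effects-trans (k ∷ ks) {u} {j} {v} (there j∈) _ _ r | inj₂ x∈ | inj₁ y∈
    with ·⁻ (effects ks u k · star (effects ks k k)) (effects ks k j) x∈
  ... | x′ , c , x′∈ , c∈ , p = ∈ₛ-++ʳ (effects ks u v)
    (·⁺ x′∈ (effects-trans ks j∈ c∈ y∈ ⊑-refl)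
      (⊑-trans r (⊑-trans (⊕-mono p ⊑-refl) (⊕-assoc x′ c _))))
  effects-trans (k ∷ ks) {u} {j} {v} (there j∈) _ _ r | inj₂ x∈ | inj₂ y∈
    with ·⁻ (effects ks u k · star (effects ks k k)) (effects ks k j) x∈
       | ·⁻ (effects ks j k · star (effects ks k k)) (effects ks k v) y∈
  ... | x′ , c , x′∈ , c∈ , p | y′ , e , y′∈ , e∈ , q
    with ·⁻ (effects ks u k) (star (effects ks k k)) x′∈ | ·⁻ (effects ks j k) (star (effects ks k k)) y′∈
  ... | a , s , a∈ , s∈ , p′ | a′ , s′ , a′∈ , s′∈ , q′ = ∈ₛ-++ʳ (effects ks u v)
    (·⁺ (·⁺ a∈ (star-star (effects ks k k) s∈
                 (star-add (effects ks k k) (effects-trans ks j∈ c∈ a′∈ ⊑-refl) s′∈ ⊑-refl) ⊑-refl)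
          ⊑-refl) e∈
      (⊑-trans r (⊑-trans (⊕-mono (⊑-trans p (⊕-mono p′ ⊑-refl)) (⊑-trans q (⊕-mono q′ ⊑-refl)))
        λ i → ≤-reflexive (regroup₆ (a i) (s i) (c i) (a′ i) (s′ i) (e i)))))
    where regroup₆ : ∀ a s c a′ s′ e →
            ((a + s) + c) + ((a′ + s′) + e) ≡ (a + (s + ((c + a′) + s′))) + e
          regroup₆ = solve-∀

  effects-complete : ∀ {u v n x} → Walk f u v (suc n) x → x ∈ₛ effects elements u v
  effects-complete (cons {z} e∈ (nil q) p) = ∈ₛ-down
    (⊑-trans p (⊑-trans (⊕-mono (⊑-refl {x = z}) q) λ i → ≤-reflexive (+-identityʳ (z i))))
    (edge∈effects elements e∈)
  effects-complete (cons {w = w} e∈ walk@(cons _ _ _) p) =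
    effects-trans elements (complete w) (edge∈effects elements e∈) (effects-complete walk) p

  loop? : ∀ s → Dec (Walk⁺ s s 𝟘)
  loop? s = map′
    (λ a → let l , l∈ , ok = find a in rows-sound
      {Φ = Walk⁺ s s}
      (record { down = λ { p (n , w) → n , walk-down p w }
              ; add = λ { (m , w) (n , w′) → _ , walk-++ w w′ } })
      l (λ x∈ → effects-sound elements (l , l∈ , x∈)) ok)
    (λ { (n , w) → let l , l∈ , x∈ = effects-complete w in lose l∈ (rows-complete l ⊑-refl x∈) })
    (any? (λ l → feasible? (rows l)) (effects elements s s))

  Reaches : Q → Q → Set
  Reaches u s = ∃₂ λ n x → Walk f u s n x

  -- Every linear set contains its base, so a nonempty walk exists exactly if the list of linear
  -- sets is nonempty.
  reaches? : ∀ u s → Dec (Reaches u s)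
  reaches? u s with u ≟ s
  ... | yes refl = yes (0 , 𝟘 , nil ⊑-refl)
  ... | no u≢s = map′ (λ { (l , l∈) → let n , w = effects-sound elements (l , l∈ , base ⊑-refl) in suc n , _ , w })
                      (λ { (zero , _ , nil _) → ⊥-elim (u≢s refl)
                         ; (suc n , _ , w) → let l , l∈ , _ = effects-complete w in l , l∈ })
                      (inhabited? (effects elements u s))
    where inhabited? : (S : Semilinear d) → Dec (∃ (_∈ S))
          inhabited? []      = no λ ()
          inhabited? (l ∷ S) = yes (l , here refl)

  Pumps : Q → Set
  Pumps q = ∃ λ s → Reaches q s × Walk⁺ s s 𝟘

  pumps? : ∀ q → Dec (Pumps q)
  pumps? q = map′ (λ a → let s , _ , h = find a in s , h) (λ { (s , h) → lose (complete s) h })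
    (any? (λ s → reaches? q s ×-dec loop? s) elements)

  solo : Game d Q
  solo = record { owns = λ _ → prob ; edges = f }

  steep : ∃ λ L → ∀ {u z w} → (z , w) ∈ f u → ∀ i → + 0 ≤ + L + z i
  steep = let N , h = uniform (λ u N → ∀ {z w} → (z , w) ∈ f u → ∀ i → + 0 ≤ + N + z i)
                        (λ m≤n h {z} e∈ i → up (z i) m≤n (h e∈ i)) elements (λ {u} _ → vertex u)
          in N , λ {u} → h (complete u)
    where
    up : ∀ {m n} z → m ℕ.≤ n → + 0 ≤ + m + z → + 0 ≤ + n + z
    up z m≤n h = ≤-trans h (+-monoˡ-≤ z (+≤+ m≤n))
    coordinate : (e : Update d × Q) → ∃ λ N → ∀ {i} → i ∈ allFin d → + 0 ≤ + N + proj₁ e i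
    coordinate (z , _) = uniform (λ i N → + 0 ≤ + N + z i) (λ {i} → up (z i)) (allFin d) (λ {i} _ → ∣ z i ∣ , absorb (z i))
    vertex : ∀ u → ∃ λ N → ∀ {z w} → (z , w) ∈ f u → ∀ i → + 0 ≤ + N + z i
    vertex u = let N , h = uniform (λ e N → ∀ i → + 0 ≤ + N + proj₁ e i) (λ {e} m≤n h i → up (proj₁ e i) m≤n (h i)) (f u)
                             (λ {e} _ → let N , h = coordinate e in N , λ i → h (∈-allFin i))
               in N , λ e∈ → h e∈

  -- The opponent walks to `s` and repeats the closed walk there. The invariant is that each counter
  -- holds `L`, the largest loss along one edge, for every edge still ahead, and will hold at least
  -- `M` on arrival at `s`, enough for a full round. Each edge shrinks the derivation of `Wins`, so
  -- there is none.
  pumps-survives : ∀ {q} → Pumps q → ∃ λ N → ¬ Wins solo q (λ _ → N)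
  pumps-survives {q} (s , (m , x , walk) , (n , loop)) =
    N , λ w → stay w walk
      (λ i → +≤+ (ℕₚ.m≤n+m (L ℕ.* m) (proj₁ offset)))
      (λ i → ≤-trans (proj₂ offset (∈-allFin i))
        (+-monoˡ-≤ (x i) (+≤+ (ℕₚ.m≤m+n (proj₁ offset) (L ℕ.* m)))))
    where
    L = proj₁ steep
    M = L ℕ.* suc n
    offset : ∃ λ K → ∀ {i} → i ∈ allFin d → + M ≤ + K + x i
    offset = uniform (λ i K → + M ≤ + K + x i) (λ {i} m≤n h → ≤-trans h (+-monoˡ-≤ (x i) (+≤+ m≤n)))
      (allFin d) (λ {i} _ → M ℕ.+ ∣ x i ∣ , enough (x i))
      where
      enough : ∀ z → + M ≤ + (M ℕ.+ ∣ z ∣) + z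
      enough z = subst (+ M ≤_) (sym (+-assoc (+ M) (+ ∣ z ∣) z))
        (≤-trans (≤-reflexive (sym (+-identityʳ (+ M)))) (+-monoʳ-≤ (+ M) (absorb z)))
    -- The first summand ensures `M` at `s` after the effect `x`; the second pays for the `m` edges
    -- leading there.
    N = proj₁ offset ℕ.+ L ℕ.* m
    descend : ∀ {a k} z → + 0 ≤ + L + z → + (L ℕ.* suc k) ≤ + a → + (L ℕ.* k) ≤ + a + z
    descend {a} {k} z bound low = ≤-trans
      (subst (+ (L ℕ.* k) ≤_) (cong (λ e → e + z) (cong +_ (trans (ℕₚ.+-comm (L ℕ.* k) L) (sym (ℕₚ.*-suc L k)))))
        (≤-trans (≤-reflexive (sym (+-identityʳ _)))
          (≤-trans (+-monoʳ-≤ (+ (L ℕ.* k)) bound) (≤-reflexive (sym (+-assoc (+ (L ℕ.* k)) (+ L) z))))))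
      (+-monoˡ-≤ z low)
    stay : ∀ {q v} → Wins solo q v → ∀ {k y} → Walk f q s k y →
      (∀ i → + (L ℕ.* k) ≤ + v i) → (∀ i → + M ≤ + v i + y i) → ⊥
    step : ∀ {q v} → Wins solo q v → ∀ {k z w y} → (z , w) ∈ f q → Walk f w s k y →
      (∀ i → + (L ℕ.* suc k) ≤ + v i) → (∀ i → + M ≤ + v i + (z i + y i)) → ⊥
    stay w (cons {z} {y = y} e∈ walk p) low high =
      step w e∈ walk low (λ i → ≤-trans (high i) (+-monoʳ-≤ (+ _) (p i)))
    stay {v = v} w (nil p) low high = again loop
      where
      M≤v : ∀ i → + M ≤ + v i
      M≤v i = ≤-trans (high i) (≤-trans (+-monoʳ-≤ (+ v i) (p i)) (≤-reflexive (+-identityʳ (+ v i))))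
      again : Walk f s s (suc n) 𝟘 → ⊥
      again (cons e∈ walk q) = step w e∈ walk M≤v
        (λ i → ≤-trans (M≤v i) (≤-trans (≤-reflexive (sym (+-identityʳ (+ v i)))) (+-monoʳ-≤ (+ v i) (q i))))
    step {v = v} (suffer _ h) {k} {z} {y = y} e∈ walk low high =
      stay (h e∈ {next} (λ i → ≤-reflexive (next≡ i))) walk
        (λ i → subst (+ (L ℕ.* k) ≤_) (sym (next≡ i)) (low′ i))
        (λ i → subst (+ M ≤_) (sym (trans (cong (λ e → e + y i) (next≡ i)) (+-assoc (+ v i) (z i) (y i)))) (high i))
      where
      low′ : ∀ i → + (L ℕ.* k) ≤ + v i + z i
      low′ i = descend {k = k} (z i) (proj₂ steep e∈ i) (low i)
      next : Counters d
      next i = ∣ + v i + z i ∣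
      next≡ : ∀ i → + next i ≡ + v i + z i
      next≡ i = 0≤i⇒+∣i∣≡i (≤-trans (+≤+ z≤n) (low′ i))

  -- The almost-full derivation acts as a bar: each edge of a play passes one `later` node, and at
  -- `now` any further edge yields a related pair, which the hypothesis excludes.
  af-wins : {R : Q × Counters d → Q × Counters d → Set} → AlmostFull R → ∀ q v →
    (∀ {q₁ v₁ q₂ v₂ m n x y} → Walk f q q₁ m x → Fits v x v₁ →
       Walk f q₁ q₂ (suc n) y → Fits v₁ y v₂ → ¬ R (q₁ , v₁) (q₂ , v₂)) →
    Wins solo q v
  af-wins (now r) q v h = suffer refl λ {z} e∈ fits → ⊥-elim
    (h (nil ⊑-refl) (λ i → ≤-reflexive (sym (+-identityʳ (+ v i))))
       (cons e∈ (nil ⊑-refl) (x⊑x⊕𝟘 {x = z})) fits (r _ _))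
  af-wins (later g) q v h = suffer refl λ {z} {q′} e∈ {v′} fits →
    let extend : ∀ {x v₁} → Fits v′ x v₁ → Fits v (z ⊕ x) v₁
        extend {x} fits₁ i = ≤-trans (fits₁ i) (≤-trans (+-monoˡ-≤ (x i) (fits i))
          (≤-reflexive (+-assoc (+ v i) (z i) (x i))))
    in af-wins (g (q , v)) q′ v′ λ where
      w₁ fits₁ w₂ fits₂ (inj₁ r) → h (cons e∈ w₁ ⊑-refl) (extend fits₁) w₂ fits₂ r
      w₁ fits₁ w₂ fits₂ (inj₂ r) → h (nil ⊑-refl) (λ i → ≤-reflexive (sym (+-identityʳ (+ v i))))
        (cons e∈ w₁ ⊑-refl) (extend fits₁) r

  private
    -- The index of the vertex and its complement both enter, so that domination forces equal
    -- vertices.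
    code : Q × Counters d → Counters (suc (suc d))
    code (q , v) zero          = toℕ (index (complete q))
    code (q , v) (suc zero)    = length elements ℕ.∸ toℕ (index (complete q))
    code (q , v) (suc (suc i)) = v i

    covering : AlmostFull (λ (c c′ : Q × Counters d) → proj₁ c ≡ proj₁ c′ × proj₂ c ≼ proj₂ c′)
    covering = af-mono (λ le → same (le zero) (le (suc zero)) , λ i → le (suc (suc i)))
      (af-comap code (dickson _))
      where
      same : ∀ {p q} → toℕ (index (complete p)) ℕ.≤ toℕ (index (complete q)) →
        length elements ℕ.∸ toℕ (index (complete p)) ℕ.≤ length elements ℕ.∸ toℕ (index (complete q)) → p ≡ q
      same {p} {q} le ge = trans (lookup-index (complete p))
        (trans (cong (List.lookup elements) (Finₚ.toℕ-injective (ℕₚ.≤-antisym le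
          (ℕₚ.∸-cancelʳ-≤ (ℕₚ.<⇒≤ (Finₚ.toℕ<n (index (complete q)))) ge))))
        (sym (lookup-index (complete q))))

  -- A vertex revisited with counters no smaller than before closes a walk of nonnegative effect.
  -- Without such walks no play contains a pair in `covering`.
  ¬pumps-wins : ∀ {q} → ¬ Pumps q → ∀ v → Wins solo q v
  ¬pumps-wins {q} ¬p v = af-wins covering q v uncovered
    where
    nonneg : ∀ n y → + n ≤ + n + y → + 0 ≤ y
    nonneg n y le = subst (+ 0 ≤_) (cancel (+ n) y) (i≤j⇒0≤j-i le)
      where cancel : ∀ n y → (n + y) + - n ≡ y
            cancel = solve-∀
    uncovered : ∀ {q₁ v₁ q₂ v₂ m n x y} → Walk f q q₁ m x → Fits v x v₁ →
      Walk f q₁ q₂ (suc n) y → Fits v₁ y v₂ → ¬ (q₁ ≡ q₂ × v₁ ≼ v₂)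
    uncovered {v₁ = v₁} {y = y} w₁ fits₁ w₂ fits₂ (refl , le) = ¬p (_ , (_ , _ , w₁) , _ , walk-down
      (λ i → nonneg (v₁ i) (y i) (≤-trans (+≤+ (le i)) (fits₂ i))) w₂)

  solo-solvable : Solvable solo
  solo-solvable = let N , h = uniform (Decided solo) decided-up elements (λ {q} _ → decide q)
                  in N , λ q → h (complete q)
    where
    decide : ∀ q → ∃ (Decided solo q)
    decide q with pumps? q
    ... | yes p = let N , ¬w = pumps-survives p in N , inj₁ ¬w
    ... | no ¬p = 0 , inj₂ (¬pumps-wins ¬p)

-- Positional choices of Player 1

owner-clash : ∀ {o} → o ≡ player1 → o ≡ prob → {A : Set} → A
owner-clash refl ()

gather : {A : Set} {P : A → Set} {B : Set} (xs : List A) →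
  (∀ {x} → x ∈ xs → P x ⊎ B) → (∀ {x} → x ∈ xs → P x) ⊎ B
gather []       h = inj₁ λ ()
gather (x ∷ xs) h with h (here refl) | gather xs (λ x∈ → h (there x∈))
... | inj₂ b | _      = inj₂ b
... | inj₁ p | inj₂ b = inj₂ b
... | inj₁ p | inj₁ q = inj₁ λ { (here refl) → p ; (there x∈) → q x∈ }

-- The exact sum is the largest successor allowed by `Fits`; by monotonicity of `Wins` it is the
-- only one that has to be examined.
advance : ∀ {d} (v : Counters d) z →
  (∃ λ w → (∀ i → + w i ≡ + v i + z i) × ∀ {v′} → Fits v z v′ → v′ ≼ w) ⊎ (∀ {v′} → ¬ Fits v z v′)
advance v z with Finₚ.all? (λ i → + 0 ≤? + v i + z i)
... | yes ok = inj₁ ((λ i → ∣ + v i + z i ∣) , (λ i → 0≤i⇒+∣i∣≡i (ok i)) ,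
  λ fits i → drop‿+≤+ (≤-trans (fits i) (≤-reflexive (sym (0≤i⇒+∣i∣≡i (ok i))))))
... | no ¬ok = inj₂ λ fits → ¬ok λ i → ≤-trans (+≤+ z≤n) (fits i)

next-wins : ∀ {d Q} {G : Game d Q} {q v z} {B : Set} →
  (∀ {v′} → Fits v z v′ → Wins G q v′ ⊎ B) → (∀ {v′} → Fits v z v′ → Wins G q v′) ⊎ B
next-wins {v = v} {z} h with advance v z
... | inj₂ stuck = inj₁ λ fits → ⊥-elim (stuck fits)
... | inj₁ (w , eq , top) with h {w} (λ i → ≤-reflexive (eq i))
...   | inj₁ win = inj₁ λ fits → wins-mono (top fits) win
...   | inj₂ b   = inj₂ b

record Restricts {d Q} (L G : Game d Q) (s : Q) : Set where
  field
    owns≡  : ∀ q → owns L q ≡ owns G q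
    edges≡ : ∀ {q} → q ≢ s → edges L q ≡ edges G q
    edges⊆ : ∀ {e} → e ∈ edges L s → e ∈ edges G s
open Restricts

module _ {d : ℕ} {Q : Set} (finite : Finite Q) where
  open Finite finite

  restrict-wins : ∀ {L G : Game d Q} {s} → owns G s ≡ player1 → Restricts L G s →
    ∀ {q v} → Wins L q v → Wins G q v
  restrict-wins {L} {G} {s} os ρ {q} (force o e∈ h) = force (trans (sym (owns≡ ρ q)) o) (move e∈)
    λ fits → restrict-wins os ρ (h fits)
    where move : ∀ {e} → e ∈ edges L q → e ∈ edges G q
          move e∈ with q ≟ s
          ... | yes refl = edges⊆ ρ e∈
          ... | no q≢s   = subst (_ ∈_) (edges≡ ρ q≢s) e∈
  restrict-wins {L} {G} {s} os ρ {q} (suffer o h) = suffer (trans (sym (owns≡ ρ q)) o)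
    λ e∈ fits → restrict-wins os ρ (h (move e∈) fits)
    where move : ∀ {e} → e ∈ edges G q → e ∈ edges L q
          move e∈ with q ≟ s
          ... | yes refl = owner-clash os (trans (sym (owns≡ ρ s)) o)
          ... | no q≢s   = subst (_ ∈_) (sym (edges≡ ρ q≢s)) e∈

  -- Plays of `G` and `L` can differ only after a visit to `s`, and there `L` is won outright.
  detour-wins : ∀ {L G : Game d Q} {s} → Restricts L G s → (∀ v → Wins L s v) →
    ∀ {q v} → Wins G q v → Wins L q v
  detour-wins {s = s} ρ all {q} w with q ≟ s
  detour-wins ρ all w | yes refl = all _
  detour-wins ρ all {q} (force o e∈ h) | no q≢s = force (trans (owns≡ ρ q) o)
    (subst (_ ∈_) (sym (edges≡ ρ q≢s)) e∈) λ fits → detour-wins ρ all (h fits)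
  detour-wins ρ all {q} (suffer o h) | no q≢s = suffer (trans (owns≡ ρ q) o)
    λ e∈ fits → detour-wins ρ all (h (subst (_ ∈_) (edges≡ ρ q≢s) e∈) fits)

  -- The opponent plays L on the counters v₁ and, paused at s, R on the counters v₂; whenever
  -- Player 1 takes at s an edge of the paused game, the roles of the two games are exchanged.
  interleave : ∀ {G : Game d Q} {s} → owns G s ≡ player1 → ∀ L R →
    Restricts L G s → Restricts R G s →
    (∀ {e} → e ∈ edges G s → e ∈ edges L s ⊎ e ∈ edges R s) →
    ∀ {q v} → Wins G q v → ∀ v₁ v₂ → (λ i → v₁ i ℕ.+ v₂ i) ≼ v → Wins L q v₁ ⊎ Wins R s v₂
  interleave {G} {s} os L R ι ρ cover {q} {v} (force o {z} {q′} e∈ h) v₁ v₂ le = try side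
    where
    side : (z , q′) ∈ edges L q ⊎ (q ≡ s × (z , q′) ∈ edges R s)
    side with q ≟ s
    ... | no q≢s = inj₁ (subst (_ ∈_) (sym (edges≡ ι q≢s)) e∈)
    ... | yes refl with cover e∈
    ...   | inj₁ m = inj₁ m
    ...   | inj₂ m = inj₂ (refl , m)
    fits₁ : ∀ {v₁′} → Fits v₁ z v₁′ → Fits v z (λ i → v₁′ i ℕ.+ v₂ i)
    fits₁ fits i = ≤-trans (+-monoˡ-≤ (+ v₂ i) (fits i))
      (≤-trans (≤-reflexive (swap-last (+ v₁ i) (z i) (+ v₂ i))) (+-monoˡ-≤ (z i) (+≤+ (le i))))
    fits₂ : ∀ {v₂′} → Fits v₂ z v₂′ → Fits v z (λ i → v₂′ i ℕ.+ v₁ i)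
    fits₂ fits i = ≤-trans (+-monoˡ-≤ (+ v₁ i) (fits i))
      (≤-trans (≤-reflexive (swap-last (+ v₂ i) (z i) (+ v₁ i)))
        (+-monoˡ-≤ (z i) (+≤+ (subst (ℕ._≤ v i) (ℕₚ.+-comm (v₁ i) (v₂ i)) (le i)))))
    try : (z , q′) ∈ edges L q ⊎ (q ≡ s × (z , q′) ∈ edges R s) → Wins L q v₁ ⊎ Wins R s v₂
    try (inj₁ m) with next-wins {G = L} {q′} {v₁} {z} (λ {v₁′} fits →
      interleave os L R ι ρ cover (h (fits₁ fits)) v₁′ v₂ (λ _ → ℕₚ.≤-refl))
    ... | inj₁ win = inj₁ (force (trans (owns≡ ι q) o) m win)
    ... | inj₂ win = inj₂ win
    -- Player 1 moves from `s` in the paused game `R`. Now `L` is the paused game, and it too stands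
    -- at `s`.
    try (inj₂ (refl , m)) with next-wins {G = R} {q′} {v₂} {z} (λ {v₂′} fits →
      interleave os R L ρ ι (λ e∈ → swap (cover e∈)) (h (fits₂ fits)) v₂′ v₁ (λ _ → ℕₚ.≤-refl))
    ... | inj₁ win = inj₂ (force (trans (owns≡ ρ q) o) m win)
    ... | inj₂ win = inj₁ win
  interleave {G} {s} os L R ι ρ cover {q} {v} (suffer o h) v₁ v₂ le =
    conclude (gather (edges G q) λ { {z , q′} e∈ → next-wins {G = L} {q′} {v₁} {z} λ {v₁′} fits →
      interleave os L R ι ρ cover
        (h e∈ (λ i → ≤-trans (+-monoˡ-≤ (+ v₂ i) (fits i))
          (≤-trans (≤-reflexive (swap-last (+ v₁ i) (z i) (+ v₂ i))) (+-monoˡ-≤ (z i) (+≤+ (le i))))))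
        v₁′ v₂ (λ _ → ℕₚ.≤-refl) })
    where
    q≢s : q ≢ s
    q≢s refl = owner-clash os o
    conclude : _ → Wins L q v₁ ⊎ Wins R s v₂
    conclude (inj₁ all) = inj₁ (suffer (trans (owns≡ ι q) o)
      λ e∈ fits → all (subst (_ ∈_) (edges≡ ι q≢s) e∈) fits)
    conclude (inj₂ win) = inj₂ win

  -- If `R` is won from `s` for every credit, `G` has the verdicts of `R`. Otherwise the opponent
  -- survives `R` from `s` with credit `n`; setting `n` aside next to `m`, `interleave` reduces `G`
  -- to `L`.
  split-solvable : ∀ {G : Game d Q} {s} → owns G s ≡ player1 → ∀ {L R} →
    Restricts L G s → Restricts R G s →
    (∀ {e} → e ∈ edges G s → e ∈ edges L s ⊎ e ∈ edges R s) →
    Solvable L → Solvable R → Solvable G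
  split-solvable {G} {s} os {L} {R} ι ρ cover (m , decL) (n , decR) with decR s
  ... | inj₂ all = n , λ q → via (decR q)
    where via : ∀ {q} → Decided R q n → Decided G q n
          via (inj₁ ¬w) = inj₁ λ w → ¬w (detour-wins ρ all w)
          via (inj₂ w)  = inj₂ λ v → restrict-wins os ρ (w v)
  ... | inj₁ ¬R = m ℕ.+ n , λ q → via (decL q)
    where
    via : ∀ {q} → Decided L q m → Decided G q (m ℕ.+ n)
    via (inj₂ w)  = inj₂ λ v → restrict-wins os ι (w v)
    via {q} (inj₁ ¬L) = inj₁ λ w → impossible
      (interleave os L R ι ρ cover w (λ _ → m) (λ _ → n) (λ _ → ℕₚ.≤-refl))
      where impossible : Wins L q (λ _ → m) ⊎ Wins R s (λ _ → n) → ⊥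
            impossible (inj₁ w) = ¬L w
            impossible (inj₂ w) = ¬R w

  AtMostOne : List (Update d × Q) → Set
  AtMostOne es = es ≡ [] ⊎ ∃ λ e → es ≡ e ∷ []

  module _ (G : Game d Q) (forced : ∀ q → owns G q ≡ player1 → AtMostOne (edges G q)) where
    -- A vertex in which Player 1 is stuck is harmless for the opponent, like an idle loop.
    branch : Owner → List (Update d × Q) → Q → List (Update d × Q)
    branch prob    es       q = es
    branch player1 []       q = (𝟘 , q) ∷ []
    branch player1 (e ∷ es) q = e ∷ []

    out : Q → List (Update d × Q)
    out q = branch (owns G q) (edges G q) q

    to-solo : ∀ {q v} → Wins G q v → Wins (solo finite out) q v
    to-solo {q} (suffer o h) = suffer refl λ e∈ fits →
      to-solo (h (subst (λ o → _ ∈ branch o (edges G q) q) o e∈) fits)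
    to-solo {q} {v} (force o {z} {q′} e∈ h) = suffer refl λ m fits → follow (same (forced q o) e∈ m) fits
      where
      same : ∀ {e e′} → AtMostOne (edges G q) → e ∈ edges G q → e′ ∈ out q → e′ ≡ e
      same one e∈ m rewrite o with edges G q | one
      same one () m | .[] | inj₁ refl
      same one (here refl) (here refl) | .(_ ∷ []) | inj₂ (_ , refl) = refl
      follow : ∀ {z₁ q₁ v′} → (z₁ , q₁) ≡ (z , q′) → Fits v z₁ v′ → Wins (solo finite out) q₁ v′
      follow refl fits = to-solo (h fits)

    from-solo : ∀ {q v} → Wins (solo finite out) q v → Wins G q v
    from-solo {q} {v} (suffer _ h) = by (owns G q) refl
      where
      by : ∀ o → owns G q ≡ o → Wins G q v
      by prob o = suffer o λ {z} {q′} e∈ fits →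
        from-solo (h (subst (λ o → (z , q′) ∈ branch o (edges G q) q) (sym o) e∈) fits)
      by player1 o with forced q o
      -- The idle loop leads back to `q` with the same counters and a smaller derivation.
      ... | inj₁ none = from-solo (h
        (subst (λ o → (𝟘 , q) ∈ branch o (edges G q) q) (sym o)
          (subst (λ es → (𝟘 , q) ∈ branch player1 es q) (sym none) (here refl)))
        (λ i → ≤-reflexive (sym (+-identityʳ (+ v i)))))
      ... | inj₂ ((z , q′) , one) = force o (subst ((z , q′) ∈_) (sym one) (here refl))
        λ fits → from-solo (h
          (subst (λ o → (z , q′) ∈ branch o (edges G q) q) (sym o)
            (subst (λ es → (z , q′) ∈ branch player1 es q) (sym one) (here refl))) fits)

    forced-solvable : Solvable G
    forced-solvable = let N , dec = solo-solvable finite out in N , λ q → via (dec q)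
      where via : ∀ {q N} → Decided (solo finite out) q N → Decided G q N
            via (inj₁ ¬w) = inj₁ λ w → ¬w (to-solo w)
            via (inj₂ w)  = inj₂ λ v → from-solo (w v)

  _[_≔_] : Game d Q → Q → List (Update d × Q) → Game d Q
  owns  (G [ s ≔ es ]) = owns G
  edges (G [ s ≔ es ]) q with q ≟ s
  ... | yes _ = es
  ... | no _  = edges G q

  edges-≔ : ∀ G s es → edges (G [ s ≔ es ]) s ≡ es
  edges-≔ G s es with s ≟ s
  ... | yes _   = refl
  ... | no s≢s = ⊥-elim (s≢s refl)

  edges-≔-other : ∀ G {s q} es → q ≢ s → edges (G [ s ≔ es ]) q ≡ edges G q
  edges-≔-other G {s} {q} es q≢s with q ≟ s
  ... | yes q≡s = ⊥-elim (q≢s q≡s)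
  ... | no _    = refl

  ≔-restricts : ∀ {G s es} → (∀ {e} → e ∈ es → e ∈ edges G s) → Restricts (G [ s ≔ es ]) G s
  ≔-restricts {G} {s} {es} sub = record
    { owns≡  = λ _ → refl
    ; edges≡ = edges-≔-other G es
    ; edges⊆ = λ e∈ → sub (subst (_ ∈_) (edges-≔ G s es) e∈)
    }

  Undecided : Game d Q → List Q → Set
  Undecided G ss = ∀ q → owns G q ≡ player1 → q ∈ ss ⊎ AtMostOne (edges G q)

  -- The outer recursion runs over the vertices whose choice may still be open; `solve-at` splits
  -- the edges at `s` into the first one and the rest.
  solve : ∀ ss G → Undecided G ss → Solvable G
  solve-at : ∀ s ss es G → edges G s ≡ es → owns G s ≡ player1 → Undecided G (s ∷ ss) → Solvable G

  solve []       G u = forced-solvable G λ q o → only (u q o)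
    where only : ∀ {q} → q ∈ [] ⊎ AtMostOne (edges G q) → AtMostOne (edges G q)
          only (inj₂ one) = one
  solve (s ∷ ss) G u = by (owns G s) refl
    where
    by : ∀ o → owns G s ≡ o → Solvable G
    by player1 o = solve-at s ss (edges G s) G refl o u
    by prob    o = solve ss G λ q o′ → drop o′ (u q o′)
      where drop : ∀ {q} → owns G q ≡ player1 → q ∈ s ∷ ss ⊎ AtMostOne (edges G q) → q ∈ ss ⊎ AtMostOne (edges G q)
            drop o′ (inj₁ (here refl)) = owner-clash o′ o
            drop o′ (inj₁ (there m))   = inj₁ m
            drop o′ (inj₂ one)         = inj₂ one

  solve-at s ss es G eq o u = go es eq
    where
    settle : ∀ G → AtMostOne (edges G s) → Undecided G (s ∷ ss) → Undecided G ss
    settle G one u q o with u q o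
    ... | inj₁ (here refl) = inj₂ one
    ... | inj₁ (there m)   = inj₁ m
    ... | inj₂ one′        = inj₂ one′
    keep : ∀ es → Undecided (G [ s ≔ es ]) (s ∷ ss)
    keep es q o with q ≟ s
    ... | yes refl = inj₁ (here refl)
    ... | no _     = u q o
    go : ∀ es → edges G s ≡ es → Solvable G
    go []           eq = solve ss G (settle G (inj₁ eq) u)
    go (e ∷ [])     eq = solve ss G (settle G (inj₂ (e , eq)) u)
    go (e ∷ e′ ∷ es) eq = split-solvable o
      (≔-restricts {es = e ∷ []} λ { (here refl) → subst (_ ∈_) (sym eq) (here refl) })
      (≔-restricts {es = e′ ∷ es} λ m → subst (_ ∈_) (sym eq) (there m))
      (λ m → side (subst (_ ∈_) eq m))
      (solve ss (G [ s ≔ e ∷ [] ]) (settle _ (inj₂ (e , edges-≔ G s _)) (keep _)))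
      (solve-at s ss (e′ ∷ es) (G [ s ≔ e′ ∷ es ]) (edges-≔ G s _) o (keep _))
      where
      side : ∀ {x} → x ∈ e ∷ e′ ∷ es →
        x ∈ edges (G [ s ≔ e ∷ [] ]) s ⊎ x ∈ edges (G [ s ≔ e′ ∷ es ]) s
      side (here refl) = inj₁ (subst (_ ∈_) (sym (edges-≔ G s _)) (here refl))
      side (there m)   = inj₂ (subst (_ ∈_) (sym (edges-≔ G s _)) m)

  solvable : ∀ G → Solvable G
  solvable G = solve elements G λ q _ → inj₁ (complete q)

-- Given initial values for some of the counters

blend : ∀ {d} → Subset d → Counters d → Counters d → Counters d
blend C v u i with i ∈? C
... | yes _ = v i
... | no  _ = u i

blend-in : ∀ {d} {C : Subset d} {v u i} → i ∈ₚ C → blend C v u i ≡ v i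
blend-in {C = C} {i = i} i∈ with i ∈? C
... | yes _ = refl
... | no i∉ = ⊥-elim (i∉ i∈)

blend-out : ∀ {d} {C : Subset d} {v u i} → i ∉ₚ C → blend C v u i ≡ u i
blend-out {C = C} {i = i} i∉ with i ∈? C
... | yes i∈ = ⊥-elim (i∉ i∈)
... | no _   = refl

blend-mono : ∀ {d} (C : Subset d) {v u w} → (∀ {i} → i ∈ₚ C → v i ℕ.≤ w i) →
  (∀ {i} → i ∉ₚ C → u i ℕ.≤ w i) → blend C v u ≼ w
blend-mono C p q i with i ∈? C
... | yes i∈ = p i∈
... | no i∉  = q i∉

≼-blend : ∀ {d} (C : Subset d) {v u w} → (∀ {i} → i ∈ₚ C → w i ℕ.≤ v i) →
  (∀ {i} → i ∉ₚ C → w i ℕ.≤ u i) → w ≼ blend C v u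
≼-blend C p q i with i ∈? C
... | yes i∈ = p i∈
... | no i∉  = q i∉

mask : ∀ {d} → Subset d → Update d → Update d
mask C z i with i ∈? C
... | yes _ = + 0
... | no  _ = z i

DecidedOn : ∀ {d Q} → Game d Q → Subset d → Q → Counters d → ℕ → Set
DecidedOn G C q v N = ¬ Wins G q (blend C v λ _ → N) ⊎ (∀ u → Wins G q (blend C v u))

-- The counters in C are given, the initial values of the others are at the opponent's discretion;
-- one value N serves the opponent whatever the given counters are.
SolvableOn : ∀ {d Q} → Game d Q → Subset d → Set
SolvableOn G C = ∃ λ N → ∀ q v → DecidedOn G C q v N

decidedOn-up : ∀ {d Q} {G : Game d Q} {C q v m n} → m ℕ.≤ n → DecidedOn G C q v m → DecidedOn G C q v n
decidedOn-up {C = C} m≤n (inj₁ ¬w) = inj₁ λ w → ¬w (wins-mono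
  (blend-mono C (λ i∈ → ℕₚ.≤-reflexive (sym (blend-in i∈)))
    (λ i∉ → ℕₚ.≤-trans m≤n (ℕₚ.≤-reflexive (sym (blend-out i∉))))) w)
decidedOn-up m≤n (inj₂ w) = inj₂ w

vectors : ∀ k d → List (Vec (Fin k) d)
vectors k zero    = [] ∷ []
vectors k (suc d) = cartesianProductWith _∷_ (allFin k) (vectors k d)

∈-vectors : ∀ {k d} (w : Vec (Fin k) d) → w ∈ vectors k d
∈-vectors []      = here refl
∈-vectors (i ∷ w) = ∈-cartesianProductWith⁺ _∷_ (∈-allFin i) (∈-vectors w)

-- The verdicts `won` and `lost` are those of the opponent: in `truncated`, `won` is a dead end of
-- Player 1, never in `Wins`, and `lost` a dead end of the opponent, always in `Wins`.
data Bounded (Q : Set) (d k : ℕ) : Set where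
  won lost : Bounded Q d k
  node     : Q → Vec (Fin k) d → Bounded Q d k

bounded-finite : ∀ {Q d k} → Finite Q → Finite (Bounded Q d k)
bounded-finite {Q} {d} {k} finite = record
  { elements = won ∷ lost ∷ cartesianProductWith node elements (vectors k d)
  ; complete = λ { won → here refl ; lost → there (here refl)
                 ; (node q w) → there (there (∈-cartesianProductWith⁺ node (complete q) (∈-vectors w))) }
  ; _≟_ = eq
  }
  where
  open Finite finite
  eq : (s t : Bounded Q d k) → Dec (s ≡ t)
  eq won won = yes refl
  eq won lost = no λ ()
  eq won (node _ _) = no λ ()
  eq lost won = no λ ()
  eq lost lost = yes refl
  eq lost (node _ _) = no λ ()
  eq (node _ _) won = no λ ()
  eq (node _ _) lost = no λ ()
  eq (node p v) (node q w) = map′ (λ { (refl , refl) → refl }) (λ { refl → refl , refl })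
    ((p ≟ q) ×-dec ≡-dec Finₚ._≟_ v w)

-- The counters in C are moved into the control states. A counter reaching K no longer matters,
-- so that the game may be stopped there with the verdict for C - c.
module Truncation {d : ℕ} {Q : Set} (finite : Finite Q) (G : Game d Q) (C : Subset d) (K : ℕ)
  (verdict : ∀ {c} → c ∈ₚ C → ∀ q v → DecidedOn G (C - c) q v K) where

  State : Set
  State = Bounded Q d (suc K)

  value : Vec (Fin (suc K)) d → Counters d
  value w i = toℕ (lookup w i)

  clamp : ∀ (v : Counters d) → (∀ {i} → i ∈ₚ C → v i ℕ.< K) → ∃ λ w → ∀ {i} → i ∈ₚ C → value w i ≡ v i
  clamp v below = tabulate entry , λ {i} i∈ → trans (cong toℕ (lookup∘tabulate entry i)) (entry-in i∈)
    where
    entry : Fin d → Fin (suc K)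
    entry i with v i ℕₚ.<? suc K
    ... | yes lt = fromℕ< lt
    -- Occurs only for counters outside `C`, whose entries carry no meaning. Taking `Fin (suc K)`
    -- makes this default exist even for `K = 0`.
    ... | no _   = zero
    entry-in : ∀ {i} → i ∈ₚ C → toℕ (entry i) ≡ v i
    entry-in {i} i∈ with v i ℕₚ.<? suc K
    ... | yes lt = Finₚ.toℕ-fromℕ< lt
    ... | no ¬lt = ⊥-elim (¬lt (ℕₚ.m<n⇒m<1+n (below i∈)))

  -- The justification for the state that replaces `q` with exact values `x` in `C`; `view-wins` and
  -- `wins-view` derive the two directions of correctness from it.
  data View (q : Q) (x : Update d) : State → Set where
    negative  : ∀ {i} → i ∈ₚ C → ¬ + 0 ≤ x i → View q x lost
    high-lost : ∀ v → (∀ {i} → i ∈ₚ C → + v i ≡ x i) → ∀ {c} → c ∈ₚ C →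
                (∀ u → Wins G q (blend (C - c) v u)) → View q x lost
    high-won  : ∀ v → (∀ {i} → i ∈ₚ C → + v i ≡ x i) → ∀ {c} → c ∈ₚ C → K ℕ.≤ v c →
                ¬ Wins G q (blend (C - c) v λ _ → K) → View q x won
    low       : ∀ w → (∀ {i} → i ∈ₚ C → + value w i ≡ x i) → View q x (node q w)

  high? : ∀ (v : Counters d) → Dec (∃ λ c → c ∈ₚ C × K ℕ.≤ v c)
  high? v = Finₚ.any? λ c → (c ∈? C) ×-dec (K ℕₚ.≤? v c)

  below-high : ∀ {v : Counters d} → ¬ (∃ λ c → c ∈ₚ C × K ℕ.≤ v c) → ∀ {i} → i ∈ₚ C → v i ℕ.< K
  below-high ¬high i∈ = ℕₚ.≰⇒> λ K≤ → ¬high (_ , i∈ , K≤)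

  classify : ∀ q x → ∃ (View q x)
  classify q x with Finₚ.any? (λ i → (i ∈? C) ×-dec ¬? (+ 0 ≤? x i))
  ... | yes (i , i∈ , neg) = lost , negative i∈ neg
  ... | no ¬neg = by-height (high? v)
    where
    v : Counters d
    v i = ∣ x i ∣
    v≡x : ∀ {i} → i ∈ₚ C → + v i ≡ x i
    v≡x {i} i∈ = 0≤i⇒+∣i∣≡i (decidable-stable (+ 0 ≤? x i) λ neg → ¬neg (i , i∈ , neg))
    by-height : Dec (∃ λ c → c ∈ₚ C × K ℕ.≤ v c) → ∃ (View q x)
    by-height (yes (c , c∈ , K≤)) with verdict c∈ q v
    ... | inj₁ ¬w = won , high-won v v≡x c∈ K≤ ¬w
    ... | inj₂ w  = lost , high-lost v v≡x c∈ w
    by-height (no ¬high) with clamp v (below-high {v} ¬high)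
    ... | w , eq = node q w , low w λ i∈ → trans (cong +_ (eq i∈)) (v≡x i∈)

  shift : Vec (Fin (suc K)) d → Update d → Update d
  shift w z i = + value w i + z i

  truncate : Vec (Fin (suc K)) d → Update d × Q → Update d × State
  truncate w (z , q) = mask C z , proj₁ (classify q (shift w z))

  truncated : Game d State
  owns  truncated won        = player1
  owns  truncated lost       = prob
  owns  truncated (node q w) = owns G q
  edges truncated won        = []
  edges truncated lost       = []
  edges truncated (node q w) = map (truncate w) (edges G q)

  Meaning : State → Counters d → Set
  Meaning won        u = ⊥
  Meaning lost       u = Unit.⊤
  Meaning (node q w) u = Wins G q (blend C (value w) u)

  view-wins : ∀ {q x t} → View q x t → ∀ {u v} → Meaning t u →
    (∀ {i} → i ∈ₚ C → + v i ≤ x i) → (∀ {i} → i ∉ₚ C → v i ℕ.≤ u i) → Wins G q v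
  view-wins (negative i∈ neg) m p r = ⊥-elim (neg (≤-trans (+≤+ z≤n) (p i∈)))
  view-wins (high-lost v eq {c} c∈ w) m p r = wins-mono
    (≼-blend (C - c) (λ i∈ → drop‿+≤+ (≤-trans (p (p─q⊆p C _ i∈)) (≤-reflexive (sym (eq (p─q⊆p C _ i∈))))))
      (λ _ → ℕₚ.≤-refl)) (w _)
  view-wins (low w eq) m p r = wins-mono
    (≼-blend C (λ i∈ → drop‿+≤+ (≤-trans (p i∈) (≤-reflexive (sym (eq i∈))))) r) m

  mask-fits : ∀ {w u z v} → Fits (blend C (value w) u) z v → Fits u (mask C z) (blend C u v)
  mask-fits {u = u} fits i with i ∈? C | fits i
  ... | yes _ | _      = ≤-reflexive (sym (+-identityʳ (+ u i)))
  ... | no _  | fits-i = fits-i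

  shift-fits : ∀ {w u z v} → Fits (blend C (value w) u) z v → ∀ {i} → i ∈ₚ C → + v i ≤ shift w z i
  shift-fits {z = z} fits {i} i∈ = subst (λ n → _ ≤ + n + z i) (blend-in i∈) (fits i)

  truncated-wins : ∀ {s u} → Wins truncated s u → Meaning s u
  truncated-wins {won}  (force _ () _)
  truncated-wins {won}  (suffer () _)
  truncated-wins {lost} _ = Unit.tt
  truncated-wins {node q w} {u} (force o e∈ h) with ∈-map⁻ (truncate w) e∈
  ... | (z , q′) , e∈ , refl = force o e∈ λ {v} fits →
    view-wins (proj₂ (classify q′ (shift w z)))
      (truncated-wins (h (mask-fits {w} {z = z} fits)))
      (shift-fits {w} {z = z} fits) (λ i∉ → ℕₚ.≤-reflexive (sym (blend-out i∉)))
  truncated-wins {node q w} {u} (suffer o h) = suffer o λ {z} {q′} e∈ {v} fits →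
    view-wins (proj₂ (classify q′ (shift w z)))
      (truncated-wins (h (∈-map⁺ (truncate w) e∈) (mask-fits {w} {z = z} fits)))
      (shift-fits {w} {z = z} fits) (λ i∉ → ℕₚ.≤-reflexive (sym (blend-out i∉)))

  -- The surplus `K` on the unknown counters is the credit that the verdict behind `high-won` grants
  -- the opponent; it is held back until that state is reached.
  record Lifts (x : Update d) (u v : Counters d) : Set where
    field
      known    : ∀ {i} → i ∈ₚ C → + v i ≡ x i
      credited : ∀ {i} → i ∉ₚ C → v i ≡ u i ℕ.+ K

  lift : ∀ {x} v → (∀ {i} → i ∈ₚ C → + v i ≡ x i) → ∀ u → Lifts x u (blend C v λ i → u i ℕ.+ K)
  lift v eq u = record { known = λ i∈ → trans (cong +_ (blend-in i∈)) (eq i∈) ; credited = blend-out }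

  lifts-fits : ∀ {w v u z u′ v′} → blend C (value w) (λ i → u i ℕ.+ K) ≼ v →
    Fits u (mask C z) u′ → Lifts (shift w z) u′ v′ → Fits v z v′
  lifts-fits {w} {v} {u} {z} {u′} {v′} le fits l i with i ∈? C | le i | fits i
  ... | yes i∈ | le-i | _ = ≤-trans (≤-reflexive (Lifts.known l i∈)) (+-monoˡ-≤ (z i) (+≤+ le-i))
  ... | no i∉ | le-i | fits-i = ≤-trans (≤-reflexive (cong +_ (Lifts.credited l i∉)))
    (≤-trans (+-monoˡ-≤ (+ K) fits-i)
      (≤-trans (≤-reflexive (swap-last (+ u i) (z i) (+ K))) (+-monoˡ-≤ (z i) (+≤+ le-i))))

  large : ∀ {v u : Counters d} c → K ℕ.≤ v c → (∀ i → K ℕ.≤ u i) → ∀ {i} → i ∉ₚ C - c → K ℕ.≤ blend C v u i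
  large c K≤v K≤u {i} i∉ with i ∈? C | i Finₚ.≟ c
  ... | no _   | _        = K≤u i
  ... | yes _  | yes refl = K≤v
  ... | yes i∈ | no i≢c   = ⊥-elim (i∉ (x∈p∧x≢y⇒x∈p-y i∈ i≢c))

  wins-view : ∀ {q x t u} → View q x t → (∀ {v} → Lifts x u v → Wins G q v) →
    (∀ {v} → Lifts x u v → ∀ w → blend C (value w) (λ i → u i ℕ.+ K) ≼ v → Wins truncated (node q w) u) →
    Wins truncated t u
  wins-view (negative _ _)      _ _ = suffer refl λ ()
  wins-view (high-lost _ _ _ _) _ _ = suffer refl λ ()
  wins-view {u = u} (high-won v eq {c} c∈ K≤ ¬w) win _ = ⊥-elim (¬w (wins-mono
    (blend-mono (C - c) (λ i∈ → ℕₚ.≤-reflexive (sym (blend-in (p─q⊆p C _ i∈)))) (large c K≤ λ i → ℕₚ.m≤n+m K (u i)))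
    (win (lift v eq u))))
  wins-view {u = u} (low w eq) _ rec = rec (lift (value w) eq u) w λ _ → ℕₚ.≤-refl

  -- Contraposed: an opponent who survives the truncated game with credit `u` survives `G` with
  -- `u + K`.
  wins-truncated : ∀ {q v} → Wins G q v → ∀ w u → blend C (value w) (λ i → u i ℕ.+ K) ≼ v →
    Wins truncated (node q w) u
  wins-truncated (force o {z} {q′} e∈ h) w u le = force o (∈-map⁺ (truncate w) e∈) λ {u′} fits →
    wins-view (proj₂ (classify q′ (shift w z))) (λ l → h (lifts-fits {w} le fits l))
      (λ l w′ → wins-truncated (h (lifts-fits {w} le fits l)) w′ u′)
  wins-truncated {q} {v} (suffer o h) w u le = suffer o λ e∈ fits → follow (∈-map⁻ (truncate w) e∈) fits
    where
    follow : ∀ {z t u′} → (∃ λ e → e ∈ edges G q × (z , t) ≡ truncate w e) → Fits u z u′ →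
      Wins truncated t u′
    follow {u′ = u′} ((z , q′) , e∈ , refl) fits =
      wins-view (proj₂ (classify q′ (shift w z))) (λ l → h e∈ (lifts-fits {w} le fits l))
        (λ l w′ → wins-truncated (h e∈ (lifts-fits {w} le fits l)) w′ u′)

  truncation-solvable : SolvableOn G C
  truncation-solvable with solvable (bounded-finite finite) truncated
  -- The part `N` serves the truncated game, the part `K` the verdicts for `C - c`, including the
  -- case of a given counter that is high from the start.
  ... | N , decide = N ℕ.+ K , λ q v → by-height q v (high? v)
    where
    by-height : ∀ q v → Dec (∃ λ c → c ∈ₚ C × K ℕ.≤ v c) → DecidedOn G C q v (N ℕ.+ K)
    by-height q v (yes (c , c∈ , K≤)) with verdict c∈ q v
    ... | inj₁ ¬w = inj₁ λ w → ¬w (wins-mono (blend-mono (C - c)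
      (λ i∈ → ℕₚ.≤-reflexive (sym (blend-in (p─q⊆p C _ i∈)))) (large c K≤ λ _ → ℕₚ.m≤n+m K N)) w)
    ... | inj₂ w = inj₂ λ u → wins-mono
      (≼-blend (C - c) (λ i∈ → ℕₚ.≤-reflexive (blend-in (p─q⊆p C _ i∈))) (λ _ → ℕₚ.≤-refl)) (w _)
    by-height q v (no ¬high) with clamp v (below-high {v} ¬high)
    ... | w , eq with decide (node q w)
    ... | inj₁ ¬w = inj₁ λ win → ¬w (wins-truncated win w (λ _ → N)
      (blend-mono C (λ i∈ → ℕₚ.≤-reflexive (trans (eq i∈) (sym (blend-in i∈))))
        (λ i∉ → ℕₚ.≤-reflexive (sym (blend-out i∉)))))
    ... | inj₂ all = inj₂ λ u → wins-mono
      (blend-mono C (λ i∈ → ℕₚ.≤-reflexive (trans (sym (eq i∈)) (sym (blend-in i∈))))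
        (λ i∉ → ℕₚ.≤-reflexive (sym (blend-out i∉))))
      (truncated-wins (all u))

abstract
  -- Induction along strict inclusion, with `K` common to all `C - c`. The empty `C` is no special
  -- case: no counter is tested, and the truncated game is `G` with all credits unknown.
  solvableOn : ∀ {d Q} → Finite Q → (G : Game d Q) → ∀ C → SolvableOn G C
  solvableOn {d} finite G C = go C (⊂-wellFounded C)
    where
    go : ∀ C → Acc _⊂_ C → SolvableOn G C
    go C (acc rec) = Truncation.truncation-solvable finite G C (proj₁ common)
      (λ {c} c∈ → proj₂ common (∈-allFin c) c∈)
      where
      common : ∃ λ K → ∀ {c} → c ∈ allFin d → c ∈ₚ C → ∀ q v → DecidedOn G (C - c) q v K
      common = uniform (λ c K → c ∈ₚ C → ∀ q v → DecidedOn G (C - c) q v K)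
        (λ m≤n h c∈ q v → decidedOn-up m≤n (h c∈ q v)) (allFin d) (λ {c} _ → one c)
        where
        one : ∀ c → ∃ λ K → c ∈ₚ C → ∀ q v → DecidedOn G (C - c) q v K
        one c with c ∈? C
        ... | yes c∈ = let K , h = go (C - c) (rec (x∈p⇒p-x⊂p c∈)) in K , λ _ → h
        ... | no c∉  = 0 , λ c∈ → ⊥-elim (c∉ c∈)

-- From VASS to energy games

least : (P : ℕ → Set) → (∀ k → Dec (P k)) → ∀ k → P k → ∃ λ m → P m × ∀ {j} → P j → m ℕ.≤ j
least P P? k p with P? 0
... | yes p₀ = 0 , p₀ , λ _ → z≤n
least P P? zero    p | no ¬p₀ = ⊥-elim (¬p₀ p)
least P P? (suc k) p | no ¬p₀ with least (λ k → P (suc k)) (λ k → P? (suc k)) k p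
... | m , pm , min = suc m , pm , λ { {zero} p₀ → ⊥-elim (¬p₀ p₀) ; {suc j} pj → s≤s (min pj) }

Next : ∀ {d} {Q : Set} → (Q → Counters d → Set) → Counters d → Update d × Q → Set
Next W v (z , q) = ∀ v′ → Fits v z v′ → W q v′

next-map : ∀ {d} {Q : Set} (W W′ : Q → Counters d → Set) → (∀ {q v} → W q v → W′ q v) →
  ∀ {v w : Counters d} → w ≼ v → ∀ e → Next W v e → Next W′ w e
next-map W W′ f le e h v′ fits = f (h v′ (fits-mono (proj₁ e) le fits))

next? : ∀ {d} {Q : Set} {W : Q → Counters d → Set} → (∀ {q v w} → w ≼ v → W q v → W q w) →
  (∀ q v → Dec (W q v)) → ∀ v e → Dec (Next W v e)
next? {W = W} mono W? v (z , q) with advance v z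
... | inj₂ stuck = yes λ _ fits → ⊥-elim (stuck fits)
... | inj₁ (w , eq , top) = map′ (λ x _ fits → mono (top fits) x) (λ h → h w λ i → ≤-reflexive (eq i)) (W? q w)

owner? : ∀ o → (o ≡ player1) ⊎ (o ≡ prob)
owner? player1 = inj₁ refl
owner? prob    = inj₂ refl

is-player1? : ∀ o → Dec (o ≡ player1)
is-player1? player1 = yes refl
is-player1? prob    = no λ ()

is-prob? : ∀ o → Dec (o ≡ prob)
is-prob? player1 = no λ ()
is-prob? prob    = yes refl

-- Winning within a bounded number of rounds

module _ {d : ℕ} {Q : Set} (G : Game d Q) where
  -- Decidable by plain recursion on the number of rounds, which can therefore be minimised.
  WinsIn : ℕ → Q → Counters d → Set
  WinsIn zero    q v = ⊥
  WinsIn (suc k) q v =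
    owns G q ≡ player1 × Any (Next (WinsIn k) v) (edges G q) ⊎
    owns G q ≡ prob × All (Next (WinsIn k) v) (edges G q)

  winsIn-mono : ∀ k {q v w} → w ≼ v → WinsIn k q v → WinsIn k q w
  winsIn-mono (suc k) le (inj₁ (o , any)) = inj₁ (o , Any.map (λ {e} → next-map (WinsIn k) (WinsIn k) (λ w → w) le e) any)
  winsIn-mono (suc k) le (inj₂ (o , all)) = inj₂ (o , All.map (λ {e} → next-map (WinsIn k) (WinsIn k) (λ w → w) le e) all)

  winsIn-up : ∀ {k l q v} → k ℕ.≤ l → WinsIn k q v → WinsIn l q v
  winsIn-up {suc k} {suc l} (s≤s k≤l) (inj₁ (o , any)) =
    inj₁ (o , Any.map (λ {e} → next-map (WinsIn k) (WinsIn l) (winsIn-up k≤l) (λ _ → ℕₚ.≤-refl) e) any)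
  winsIn-up {suc k} {suc l} (s≤s k≤l) (inj₂ (o , all)) =
    inj₂ (o , All.map (λ {e} → next-map (WinsIn k) (WinsIn l) (winsIn-up k≤l) (λ _ → ℕₚ.≤-refl) e) all)

  winsIn? : ∀ k q v → Dec (WinsIn k q v)
  winsIn? zero    q v = no λ ()
  winsIn? (suc k) q v =
    (is-player1? (owns G q) ×-dec any? (next? (winsIn-mono k) (winsIn? k) v) (edges G q)) ⊎-dec
    (is-prob? (owns G q) ×-dec all? (next? (winsIn-mono k) (winsIn? k) v) (edges G q))

  winsIn-wins : ∀ k {q v} → WinsIn k q v → Wins G q v
  winsIn-wins (suc k) (inj₁ (o , any)) = let _ , e∈ , h = find any in
    force o e∈ λ fits → winsIn-wins k (h _ fits)
  winsIn-wins (suc k) (inj₂ (o , all)) = suffer o λ e∈ fits → winsIn-wins k (All.lookup all e∈ _ fits)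

  -- Only the largest successor along each of finitely many edges matters, so the numbers of rounds
  -- have a common bound.
  wins-winsIn : ∀ {q v} → Wins G q v → ∃ λ k → WinsIn k q v
  wins-winsIn {q} {v} (force o {z} {q′} e∈ h) with advance v z
  ... | inj₂ stuck = 1 , inj₁ (o , lose e∈ λ _ fits → ⊥-elim (stuck fits))
  ... | inj₁ (w , eq , top) with wins-winsIn (h {w} λ i → ≤-reflexive (eq i))
  ... | k , win = suc k , inj₁ (o , lose e∈ λ _ fits → winsIn-mono k (top fits) win)
  wins-winsIn {q} {v} (suffer o h) with uniform (λ e k → Next (WinsIn k) v e)
    (λ {e} {m} {n} m≤n → next-map (WinsIn m) (WinsIn n) (winsIn-up m≤n) (λ _ → ℕₚ.≤-refl) e) (edges G q) edge
    where
    edge : ∀ {e} → e ∈ edges G q → ∃ λ k → Next (WinsIn k) v e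
    edge {z , q′} e∈ with advance v z
    ... | inj₂ stuck = 0 , λ _ fits → stuck fits
    ... | inj₁ (w , eq , top) with wins-winsIn (h e∈ {w} λ i → ≤-reflexive (eq i))
    ... | k , win = k , λ _ fits → winsIn-mono k (top fits) win
  ... | k , all = suc k , inj₂ (o , All.tabulate all)

fin-finite : ∀ n → Finite (Fin n)
fin-finite n = record { elements = allFin n ; complete = ∈-allFin ; _≟_ = Finₚ._≟_ }

lookup-ext : ∀ {A : Set} {n} {xs ys : Vec A n} → (∀ i → lookup xs i ≡ lookup ys i) → xs ≡ ys
lookup-ext {xs = xs} {ys} h =
  trans (sym (tabulate∘lookup xs)) (trans (tabulate-cong h) (tabulate∘lookup ys))

prefix-snoc : ∀ {A : Set} (ρ : ℕ → A) k → prefix ρ (suc k) ≡ prefix ρ k ++ ρ k ∷ []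
prefix-snoc ρ zero    = refl
prefix-snoc ρ (suc k) = cong (ρ 0 ∷_) (prefix-snoc (λ j → ρ (suc j)) k)

-- The energy game of a P-VASS-MDP

module Translation {n d : ℕ} (S : VASSMDP n d) (pvass : IsPVASS S) (live : DeadlockFree S) (qF : Fin n) where

  cost : Fin n → ℕ
  cost q with q Finₚ.≟ qF
  ... | yes _ = 1
  ... | no _  = 0

  cost-F : ∀ {q} → q ≡ qF → cost q ≡ 1
  cost-F {q} q≡F with q Finₚ.≟ qF
  ... | yes _  = refl
  ... | no q≢F = ⊥-elim (q≢F q≡F)

  cost-other : ∀ {q} → q ≢ qF → cost q ≡ 0
  cost-other {q} q≢F with q Finₚ.≟ qF
  ... | yes q≡F = ⊥-elim (q≢F q≡F)
  ... | no _    = refl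

  update : Transition n d → Update (suc d)
  update t zero    = - + cost (src t)
  update t (suc i) = lookup (upd t) i

  toEdge : Transition n d → Update (suc d) × Fin n
  toEdge t = update t , tgt t

  game : Game (suc d) (Fin n)
  game = record
    { owns  = owner S
    ; edges = λ q → map toEdge (filter (λ t → src t Finₚ.≟ q) (transitions S))
    }

  edge⁺ : ∀ {t q} → t ∈ transitions S → src t ≡ q → toEdge t ∈ edges game q
  edge⁺ {q = q} t∈ s = ∈-map⁺ toEdge (∈-filter⁺ (λ t → src t Finₚ.≟ q) t∈ s)

  edge⁻ : ∀ {e q} → e ∈ edges game q → ∃ λ t → t ∈ transitions S × src t ≡ q × e ≡ toEdge t
  edge⁻ {q = q} e∈ with ∈-map⁻ toEdge e∈
  ... | t , t∈′ , eq with ∈-filter⁻ (λ t → src t Finₚ.≟ q) {xs = transitions S} t∈′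
  ... | t∈ , s = t , t∈ , s , eq

  counters : ℕ → Vec ℕ d → Counters (suc d)
  counters m v zero    = m
  counters m v (suc i) = lookup v i

  WinsAt : Config n d → ℕ → Set
  WinsAt (q , v) m = Wins game q (counters m v)

  WinsInAt : ℕ → Config n d → ℕ → Set
  WinsInAt k (q , v) m = WinsIn game k q (counters m v)

  fires⁺ : ∀ {t : Transition n d} {q v v′} → src t ≡ q →
    (∀ i → + lookup v′ i ≡ + lookup v i + lookup (upd t) i) → Fires t (q , v) (tgt t , v′)
  fires⁺ {t} {v = v} {v′} s eq = s , refl , lookup-ext λ i →
    trans (lookup-zipWith _+_ i (Vec.map +_ v) (upd t))
      (trans (cong (λ e → e + lookup (upd t) i) (lookup-map i +_ v))
        (trans (sym (eq i)) (sym (lookup-map i +_ v′))))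

  fires⁻ : ∀ {t : Transition n d} {q v q′ v′} → Fires t (q , v) (q′ , v′) →
    ∀ i → + lookup v′ i ≡ + lookup v i + lookup (upd t) i
  fires⁻ {t} {v = v} {v′ = v′} (_ , _ , eq) i =
    trans (sym (lookup-map i +_ v′)) (trans (cong (λ x → lookup x i) (sym eq))
      (trans (lookup-zipWith _+_ i (Vec.map +_ v) (upd t))
        (cong (λ e → e + lookup (upd t) i) (lookup-map i +_ v))))

  private
    add-sub : ∀ m c → (m + c) + - c ≡ m
    add-sub = solve-∀
    sub-add : ∀ m c → (m + - c) + c ≡ m
    sub-add = solve-∀

    pay : ∀ {m m′ c} → m′ ℕ.+ c ℕ.≤ m → + m′ ≤ + m + - + c
    pay {m} {m′} {c} le = ≤-trans (≤-reflexive (sym (add-sub (+ m′) (+ c)))) (+-monoˡ-≤ (- + c) (+≤+ le))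

    paid : ∀ {m m′ c} → + m′ ≤ + m + - + c → m′ ℕ.+ c ℕ.≤ m
    paid {m} {m′} {c} le = drop‿+≤+ (≤-trans (+-monoˡ-≤ (+ c) le) (≤-reflexive (sub-add (+ m) (+ c))))

  fires-fits : ∀ {t : Transition n d} {q v q′ v′ m m′} → Fires t (q , v) (q′ , v′) →
    m′ ℕ.+ cost q ℕ.≤ m → Fits (counters m v) (update t) (counters m′ v′)
  fires-fits {t} (refl , _)  le zero    = pay le
  fires-fits {t} {v′ = v′} fires le (suc i) = ≤-reflexive (fires⁻ {t} {v′ = v′} fires i)

  fires-top : ∀ {t : Transition n d} {q v q′ v′ m w} → Fires t (q , v) (q′ , v′) →
    Fits (counters m v) (update t) w → w ≼ counters (m ℕ.∸ cost q) v′
  fires-top {t} {m = m} {w} (refl , _) fits zero =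
    ℕₚ.m+n≤o⇒m≤o∸n (w zero) (paid {m} {w zero} {cost (src t)} (fits zero))
  fires-top {t} {v′ = v′} fires fits (suc i) =
    drop‿+≤+ (≤-trans (fits (suc i)) (≤-reflexive (sym (fires⁻ {t} {v′ = v′} fires i))))

  -- With all counters given no credit remains to be chosen, and the verdict becomes a decision.
  wins? : ∀ q v → Dec (Wins game q v)
  wins? q v with proj₂ (solvableOn (fin-finite n) game ⊤) q v
  ... | inj₁ ¬w = no λ w → ¬w (wins-mono (blend-mono ⊤ (λ _ → ℕₚ.≤-refl) (λ i∉ → ⊥-elim (i∉ ∈⊤))) w)
  ... | inj₂ w  = yes (wins-mono (≼-blend ⊤ (λ _ → ℕₚ.≤-refl) (λ i∉ → ⊥-elim (i∉ ∈⊤))) (w v))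

  -- Only the extra counter `zero` is unknown; `N` is uniform in the values of all the others.
  credit : ∃ λ N → ∀ c → ¬ WinsAt c N ⊎ (∀ m → WinsAt c m)
  credit with solvableOn (fin-finite n) game (outside ∷ ⊤)
  ... | N , decide = N , λ { (q , v) → via q v (decide q (counters 0 v)) }
    where
    via : ∀ q v → DecidedOn game (outside ∷ ⊤) q (counters 0 v) N → ¬ WinsAt (q , v) N ⊎ (∀ m → WinsAt (q , v) m)
    via q v (inj₁ ¬w) = inj₁ λ w → ¬w (wins-mono
      (λ { zero → ℕₚ.≤-refl
         ; (suc i) → ℕₚ.≤-reflexive (blend-in {C = outside ∷ ⊤} {v = counters 0 v} (there ∈⊤)) }) w)
    via q v (inj₂ w) = inj₂ λ m → wins-mono
      (λ { zero → ℕₚ.≤-refl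
         ; (suc i) → ℕₚ.≤-reflexive (sym (blend-in {C = outside ∷ ⊤} {v = counters 0 v} (there ∈⊤))) })
      (w (λ _ → m))

  -- Deadlock-freedom only refutes the absence of a step; a search through the transitions finds
  -- one.
  some-step : ∀ c → ∃ λ c′ → Step S c c′
  some-step c@(q , v) = from (gather (transitions S) λ {t} t∈ → try t t∈)
    where
    try : ∀ t → t ∈ transitions S → (∀ c′ → ¬ Fires t c c′) ⊎ (∃ λ c′ → Step S c c′)
    try t t∈ with src t Finₚ.≟ q | advance (lookup v) (lookup (upd t))
    ... | no s≢q  | _ = inj₁ λ _ fires → s≢q (proj₁ fires)
    ... | yes _   | inj₂ stuck = inj₁ λ c′ fires → stuck λ i → ≤-reflexive (fires⁻ {t} {v′ = proj₂ c′} fires i)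
    ... | yes s≡q | inj₁ (w , eq , _) = inj₂ ((tgt t , tabulate w) , t , t∈ ,
      fires⁺ {t} s≡q λ i → trans (cong +_ (lookup∘tabulate w i)) (eq i))
    from : (∀ {t} → t ∈ transitions S → ∀ c′ → ¬ Fires t c c′) ⊎ (∃ λ c′ → Step S c c′) →
      ∃ λ c′ → Step S c c′
    from (inj₁ none) = ⊥-elim (live c λ { c′ (t , t∈ , fires) → none t∈ c′ fires })
    from (inj₂ step) = step

  -- Here the P-VASS condition enters: transitions of Player 1 are never disabled, so an edge chosen
  -- in `game` is a legal move in `S`.
  still : ∀ {t v} → t ∈ transitions S → owner S (src t) ≡ player1 → Fires t (src t , v) (tgt t , v)
  still {t} {v} t∈ o = fires⁺ {t} refl λ i → sym (trans
    (cong (λ z → + lookup v i + z) (trans (cong (λ z → lookup z i) (pvass t t∈ o)) (lookup-replicate i (+ 0))))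
    (+-identityʳ (+ lookup v i)))

  -- Minimality of the number of rounds left makes the memoryless strategy progress.
  pick : ∀ m₀ c → ∃ λ c′ → Step S c c′ ×
    (owner S (state c) ≡ player1 → ∀ {k} → WinsInAt (suc k) c m₀ →
       ∀ {m} → m ℕ.+ cost (state c) ℕ.≤ m₀ → WinsInAt k c′ m)
  pick m₀ c@(q , v) with wins? q (counters m₀ v)
  ... | no ¬w = let c′ , step = some-step c in
    c′ , step , λ _ {k} win → ⊥-elim (¬w (winsIn-wins game (suc k) win))
  ... | yes w with wins-winsIn game w
  ... | k₀ , win₀ with least (λ k → WinsInAt k c m₀) (λ k → winsIn? game k q (counters m₀ v)) k₀ win₀
  ... | suc j , inj₂ (o , _) , _ = let c′ , step = some-step c in
    c′ , step , λ o′ → owner-clash o′ o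
  ... | suc j , inj₁ (o , any) , min with find any
  ... | e , e∈ , h with edge⁻ e∈
  ... | t , t∈ , refl , refl = (tgt t , v) , (t , t∈ , still {t} {v} t∈ o) , λ _ {k} win le →
    winsIn-up game (ℕₚ.≤-pred (min {suc k} win)) (h _ (fires-fits {t} {v′ = v} (still {t} {v} t∈ o) le))

  -- The strategy plays as if the extra counter always stood at `m₀`, which makes it memoryless.
  positional : ℕ → Strategy S
  positional m₀ = record
    { choose = λ _ c → proj₁ (pick m₀ c)
    ; valid  = λ ρ k _ _ _ → proj₁ (proj₂ (pick m₀ (ρ k)))
    }

  module _ (m₀ : ℕ) (ρ : ℕ → Config n d) (steps : ∀ i → Step S (ρ i) (ρ (suc i)))
    (consistent : ∀ i → Consistent (positional m₀) ρ i) where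

    descend : ∀ {k} i {m} → m ℕ.+ cost (state (ρ i)) ℕ.≤ m₀ → WinsInAt (suc k) (ρ i) m₀ → WinsInAt k (ρ (suc i)) m
    descend {k} i {m} le win@(inj₁ (o , _)) = subst (λ c → WinsInAt k c m) (sym (consistent i o))
      (proj₂ (proj₂ (pick m₀ (ρ i))) o {k} win le)
    descend i {m} le (inj₂ (_ , all)) with steps i
    ... | t , t∈ , fires@(s , refl , _) =
      All.lookup all (edge⁺ t∈ s) _ (fires-fits {t} {v′ = proj₂ (ρ (suc i))} fires le)

    -- Away from `qF` nothing is paid: the credit stays `m₀` while the number of rounds left
    -- decreases, and with no rounds left nothing is won.
    visits : ∀ k i → WinsInAt k (ρ i) m₀ → ∃ λ j → i ℕ.≤ j × state (ρ j) ≡ qF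
    visits (suc k) i win with state (ρ i) Finₚ.≟ qF
    ... | yes F = i , ℕₚ.≤-refl , F
    ... | no ¬F with visits k (suc i) (descend {k} i
      (ℕₚ.≤-reflexive (trans (cong (m₀ ℕ.+_) (cost-other ¬F)) (ℕₚ.+-identityʳ m₀))) win)
    ...   | j , i<j , F = j , ℕₚ.<⇒≤ i<j , F

  reach-positive : ∀ {c₀} → WinsAt c₀ 0 → SureReach S c₀ qF
  reach-positive {c₀} w = positional 0 , λ
    { (fin k ρ) (_ , _ , dead , _) → ⊥-elim (live (ρ k) dead)
    ; (inf ρ) (refl , steps , consistent) →
        let k , win = wins-winsIn game w
            j , _ , F = visits 0 ρ steps consistent k 0 win
        in j , F
    }

  -- Credit `suc N` leaves at least `N` after any step, even one out of `qF`, and winning with `N`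
  -- means winning with every credit. So the play stays winning for `suc N`, and `visits` applies
  -- from every position.
  repeat-positive : ∀ {c₀} → (∀ m → WinsAt c₀ m) → SureRepReach S c₀ qF
  repeat-positive {c₀} w = positional (suc N) , λ
    { (fin k ρ) (_ , _ , dead , _) → ⊥-elim (live (ρ k) dead)
    ; (inf ρ) (refl , steps , consistent) i →
        let k , win = wins-winsIn game (always ρ steps consistent w i (suc N))
        in visits (suc N) ρ steps consistent k i win
    }
    where
    N = proj₁ credit
    unlimited : ∀ {c} → WinsAt c N → ∀ m → WinsAt c m
    unlimited {c} w with proj₂ credit c
    ... | inj₁ ¬w  = ⊥-elim (¬w w)
    ... | inj₂ all = all
    cost≤1 : ∀ q → cost q ℕ.≤ 1
    cost≤1 q with q Finₚ.≟ qF
    ... | yes _ = s≤s z≤n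
    ... | no _  = z≤n
    always : ∀ ρ → (∀ i → Step S (ρ i) (ρ (suc i))) → (∀ i → Consistent (positional (suc N)) ρ i) →
      (∀ m → WinsAt (ρ 0) m) → ∀ i m → WinsAt (ρ i) m
    always ρ steps consistent w zero    = w
    always ρ steps consistent w (suc i) with wins-winsIn game (always ρ steps consistent w i (suc N))
    ... | suc k , win = unlimited (winsIn-wins game k (descend (suc N) ρ steps consistent {k} i
      (subst (N ℕ.+ cost (state (ρ i)) ℕ.≤_) (ℕₚ.+-comm N 1) (ℕₚ.+-monoʳ-≤ N (cost≤1 (state (ρ i))))) win))

  -- If the opponent could not pay for this step, or lost after it, `force` along its edge would
  -- win.
  player1-step : ∀ {c c′ m} → owner S (state c) ≡ player1 → Step S c c′ → ¬ WinsAt c m →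
    cost (state c) ℕ.≤ m × ¬ WinsAt c′ (m ℕ.∸ cost (state c))
  player1-step {q , v} {q′ , v′} {m} o (t , t∈ , fires@(s , refl , _)) ¬w =
    decidable-stable (cost q ℕₚ.≤? m) (λ poor → ¬w (force o (edge⁺ t∈ s) λ {w} fits → ⊥-elim (poor (afford s (fits zero))))) ,
    λ w → ¬w (force o (edge⁺ t∈ s) λ fits → wins-mono (fires-top {t} {v′ = v′} fires fits) w)
    where
    afford : ∀ {k} → src t ≡ q → + k ≤ + m + - + cost (src t) → cost q ℕ.≤ m
    afford {k} refl le = ℕₚ.≤-trans (ℕₚ.m≤n+m (cost q) k) (paid le)

  -- Decidability of `Wins` turns the failure of `suffer` into a concrete successor that is not won.
  prob-step : ∀ c m → owner S (state c) ≡ prob → ¬ WinsAt c m →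
    ∃ λ c′ → Step S c c′ × cost (state c) ℕ.≤ m × ¬ WinsAt c′ (m ℕ.∸ cost (state c))
  prob-step c@(q , v) m o ¬w = from (gather (edges game q) try)
    where
    Escape : Set
    Escape = ∃ λ c′ → Step S c c′ × cost (state c) ℕ.≤ m × ¬ WinsAt c′ (m ℕ.∸ cost (state c))
    try : ∀ {e} → e ∈ edges game q → Next (Wins game) (counters m v) e ⊎ Escape
    try e∈ with edge⁻ e∈
    ... | t , t∈ , refl , refl with advance (counters m v) (update t)
    ... | inj₂ stuck = inj₁ λ _ fits → ⊥-elim (stuck fits)
    ... | inj₁ (w , eq , top) with wins? (tgt t) w
    ... | yes win = inj₁ λ _ fits → wins-mono (top fits) win
    ... | no ¬win = inj₂ ((tgt t , v′) , (t , t∈ , fires) , ℕₚ.≤-trans (ℕₚ.m≤n+m _ (w zero)) (paid (fits zero)) ,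
      λ win → ¬win (wins-mono (fires-top {t} {v′ = v′} fires fits) win))
      where
      v′ : Vec ℕ d
      v′ = tabulate λ i → w (suc i)
      fires : Fires t (src t , v) (tgt t , v′)
      fires = fires⁺ {t} refl λ i → trans (cong +_ (lookup∘tabulate (λ i → w (suc i)) i)) (eq (suc i))
      fits : Fits (counters m v) (update t) w
      fits i = ≤-reflexive (eq i)
    from : (∀ {e} → e ∈ edges game q → Next (Wins game) (counters m v) e) ⊎ Escape → Escape
    from (inj₁ all) = ⊥-elim (¬w (suffer o λ e∈ fits → all e∈ _ fits))
    from (inj₂ esc) = esc

  -- The successor is computed without a proof of `¬ WinsAt c m`, because `stage` is defined before
  -- its invariant is established; hence the default `c`.
  respond : ∀ c m → ∃ λ c′ → owner S (state c) ≡ prob → ¬ WinsAt c m →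
    Step S c c′ × cost (state c) ℕ.≤ m × ¬ WinsAt c′ (m ℕ.∸ cost (state c))
  respond c@(q , v) m with wins? q (counters m v) | owner? (owner S q)
  ... | yes w | _      = c , λ _ ¬w → ⊥-elim (¬w w)
  ... | no _  | inj₁ o = c , λ o′ _ → owner-clash o o′
  ... | no ¬w | inj₂ o = let c′ , h = prob-step c m o ¬w in c′ , λ _ _ → h

  module Counterplay (σ : Strategy S) (c₀ : Config n d) (m : ℕ) (¬w : ¬ WinsAt c₀ m) where
    turn : Owner → List (Config n d) → Config n d → ℕ → Config n d
    turn player1 h c k = Strategy.choose σ h c
    turn prob    h c k = proj₁ (respond c k)

    stage : ℕ → List (Config n d) × Config n d × ℕ
    stage zero    = [] , c₀ , m
    stage (suc i) = let h , c , k = stage i in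
      -- The truncated subtraction is exact, since `Safe` shows that the cost is covered.
      h ++ c ∷ [] , turn (owner S (state c)) h c k , k ℕ.∸ cost (state c)

    ρ : ℕ → Config n d
    ρ i = proj₁ (proj₂ (stage i))

    μ : ℕ → ℕ
    μ i = proj₂ (proj₂ (stage i))

    history : ∀ i → prefix ρ i ≡ proj₁ (stage i)
    history zero    = refl
    history (suc i) = trans (prefix-snoc ρ i) (cong (_++ ρ i ∷ []) (history i))

    consistent : ∀ i → Consistent σ ρ i
    consistent i o = trans (cong (λ o → turn o (proj₁ (stage i)) (ρ i) (μ i)) o)
      (cong (λ h → Strategy.choose σ h (ρ i)) (sym (history i)))

    Safe : ℕ → Set
    Safe i = Step S (ρ i) (ρ (suc i)) × cost (state (ρ i)) ℕ.≤ μ i × ¬ WinsAt (ρ (suc i)) (μ (suc i))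

    safe-step : ∀ i → IsPlayUpTo S ρ i → ¬ WinsAt (ρ i) (μ i) → Safe i
    safe-step i play ¬w with owner? (owner S (state (ρ i)))
    ... | inj₁ o =
      let step = subst (Step S (ρ i)) (sym (consistent i o)) (valid σ ρ i play o (some-step (ρ i)))
      in step , player1-step o step ¬w
    ... | inj₂ o = subst (λ c → Step S (ρ i) c × cost (state (ρ i)) ℕ.≤ μ i × ¬ WinsAt c (μ (suc i)))
      (sym (cong (λ o → turn o (proj₁ (stage i)) (ρ i) (μ i)) o))
      (proj₂ (respond (ρ i) (μ i)) o ¬w)

    invariant : ∀ i → IsPlayUpTo S ρ i × ¬ WinsAt (ρ i) (μ i)
    invariant zero    = (λ _ ()) , ¬w
    invariant (suc i) with invariant i
    ... | play , ¬wᵢ with safe-step i play ¬wᵢ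
    ... | step , _ , ¬wₛ = extend , ¬wₛ
      where
      extend : IsPlayUpTo S ρ (suc i)
      extend j (s≤s j≤i) with ℕₚ.m≤n⇒m<n∨m≡n j≤i
      ... | inj₁ j<i  = play j j<i
      ... | inj₂ refl = step

    safe : ∀ i → Safe i
    safe i = let play , ¬wᵢ = invariant i in safe-step i play ¬wᵢ

    outcome : Outcome S c₀ σ (inf ρ)
    outcome = refl , (λ i → proj₁ (safe i)) , consistent

    μ-antitone : ∀ {i j} → i ℕ.≤′ j → μ j ℕ.≤ μ i
    μ-antitone ℕ.≤′-refl        = ℕₚ.≤-refl
    μ-antitone (ℕ.≤′-step {j} le) = ℕₚ.≤-trans (ℕₚ.m∸n≤m (μ j) (cost (state (ρ j)))) (μ-antitone le)

    μ-drops : ∀ i → state (ρ i) ≡ qF → μ (suc i) ℕ.< μ i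
    μ-drops i F with proj₁ (proj₂ (safe i))
    ... | le rewrite cost-F F = ℕₚ.≤-reflexive (trans (ℕₚ.+-comm 1 (μ i ℕ.∸ 1)) (ℕₚ.m∸n+n≡m le))

    -- Each visit lowers `μ`, which never increases, so at most `μ 0` visits fit in.
    finitely-often : ¬ (∀ N → ∃ λ i → N ℕ.≤ i × state (ρ i) ≡ qF)
    finitely-often often = exhaust (μ 0) 0 ℕₚ.≤-refl
      where
      exhaust : ∀ k i → μ i ℕ.≤ k → ⊥
      exhaust k i le with often i
      ... | j , i≤j , F with ℕₚ.≤-trans (μ-drops j F) (ℕₚ.≤-trans (μ-antitone (ℕₚ.≤⇒≤′ i≤j)) le)
      exhaust (suc k) i le | j , _ , _ | s≤s drop = exhaust k (suc j) drop

  -- With credit 0 a single visit would push `μ` below 0.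
  reach-negative : ∀ {c₀} → ¬ WinsAt c₀ 0 → ¬ SureReach S c₀ qF
  reach-negative {c₀} ¬w (σ , sure) with sure (inf ρ) outcome
    where open Counterplay σ c₀ 0 ¬w
  ... | i , F with ℕₚ.≤-trans (μ-drops i F) (μ-antitone (ℕₚ.≤⇒≤′ (z≤n {i})))
    where open Counterplay σ c₀ 0 ¬w
  ... | ()

  repeat-negative : ∀ {c₀ m} → ¬ WinsAt c₀ m → ¬ SureRepReach S c₀ qF
  repeat-negative {c₀} {m} ¬w (σ , sure) = finitely-often (sure (inf ρ) outcome)
    where open Counterplay σ c₀ m ¬w

  sure-reach? : ∀ c₀ → Dec (SureReach S c₀ qF)
  sure-reach? (q , v) with wins? q (counters 0 v)
  ... | yes w = yes (reach-positive w)
  ... | no ¬w = no (reach-negative ¬w)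

  sure-repeated-reach? : ∀ c₀ → Dec (SureRepReach S c₀ qF)
  sure-repeated-reach? c₀ with proj₂ credit c₀
  ... | inj₁ ¬w  = no (repeat-negative ¬w)
  ... | inj₂ all = yes (repeat-positive all)

theorem4 : ((n d : ℕ) (S : VASSMDP n d) → IsPVASS S → DeadlockFree S →
    (c₀ : Config n d) (qF : Fin n) → Dec (SureReach S c₀ qF))
    × ((n d : ℕ) (S : VASSMDP n d) → IsPVASS S → DeadlockFree S →
    (c₀ : Config n d) (qF : Fin n) → Dec (SureRepReach S c₀ qF))
theorem4 = (λ n d S pvass live c₀ qF → Translation.sure-reach? S pvass live qF c₀)
         , (λ n d S pvass live c₀ qF → Translation.sure-repeated-reach? S pvass live qF c₀)
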